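{- Let $n\geq 1$ and let $\sigma\vdash[k]$ and $\tau\vdash[l]$ be set partitions. In $\mathrm{NCSym}$, the coefficient of $x_\sigma\otimes x_\tau$ in $\Delta(x_{\llbracket n\rrbracket})$ (expanded in the basis of tensors $x_{\alpha}\otimes x_{\beta}$, with $\alpha,\beta$ set partitions) is $$\sum (-1)^{\ell(\nu)-1}(\ell(\nu)-1)!,$$ where the sum is over all triples $(\nu,S_1,S_2)$ such that $\nu\vdash[n]$, $[n]=S_1\sqcup S_2$, $\nu=\nu|_{S_1}\sqcup\nu|_{S_2}$, $\sigma\leq \mathrm{St}(\nu|_{S_1})$, and $\tau\leq\mathrm{St}(\nu|_{S_2})$.
   Context: $[n]=\{1,\dots,n\}$, $[0]=\emptyset$. A set partition $\pi\vdash S$ of a finite set $S$ is a collection of disjoint nonempty subsets (blocks) with union $S$; $\ell(\pi)$ is its number of blocks; the empty set has a unique set partition $\emptyset$. $\llbracket n\rrbracket\vdash[n]$ is the set partition with a single block $[n]$. A decomposition $[n]=S_1\sqcup S_2$ is an ordered pair of disjoint, possibly empty, subsets with union $[n]$. For $T\subseteq S$, $\pi|_T$ is the set partition of $T$ whose blocks are the nonempty intersections of blocks of $\pi$ with $T$. For set partitions $A$ and $B$ of disjoint sets, $A\sqcup B$ is the set partition of the union whose blocks are the blocks of $A$ together with those of $B$. For a finite set $S$ of integers and $A\vdash S$, $\mathrm{St}(A)\vdash[|S|]$ is obtained by relabelling via the unique order-preserving bijection $S\to[|S|]$. Set partitions of a common set are ordered by refinement: $\sigma\leq\pi$ if each block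 of $\sigma$ is contained in a block of $\pi$ (so $\sigma\leq \mathrm{St}(\nu|_{S_1})$ requires in particular that both are set partitions of the same set, i.e. $|S_1|=k$, and likewise $|S_2|=l$). $u$ is the Möbius function of the refinement lattice: for $\sigma\le\pi$, $u(\sigma,\pi)=\prod_i(-1)^{\lambda_i-1}(\lambda_i-1)!$ with $\lambda_i$ the number of blocks of $\sigma$ contained in the $i$th block of $\pi$. $\mathrm{NCSym}$ is the Hopf algebra of symmetric functions in noncommuting variables over $\mathbb{Q}$. It is graded, with basis $\{p_\pi\}$ indexed by all set partitions $\pi\vdash[n]$, $n\ge0$ ($p_\emptyset=1$), where $p_\pi=\sum \mathbf{x}_{i_1}\cdots\mathbf{x}_{i_n}$ over all tuples of positive integers $(i_1,\dots,i_n)$ with $i_j=i_k$ whenever $j,k$ are in the same block of $\pi$, the $\mathbf{x}_i$ being noncommuting variables. Its coproduct is the linear map determined by $$\Delta(p_\pi)=\sum_{[n]=S_1\sqcup S_2:\ \pi=\pi|_{S_1}\sqcup\pi|_{S_2}}p_{\mathrm{St}(\pi|_{S_1})}\otimes p_{\mathrm{St}(\pi|_{S_2})}\qquad(\pi\vdash[n]).$$ The $x$-basis of $\mathrm{NCSym}$ is $\{x_\pi\}$, where $x_\pi=\sum_{\sigma\leq\pi}u(\sigma,\pi)\,p_\sigma$. -}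

module Defs where

open import Level using (Level; 0ℓ; _⊔_)
open import Algebra.Bundles using (CommutativeRing; RawMonoid)
open import Algebra.Module.Bundles using (LeftModule)
open import Algebra.Module.Morphism.Structures using (module LeftModuleMorphisms)
open import Data.Bool using (if_then_else_)
import Data.Bool.Properties as Bool
open import Data.Fin using (Fin; cast)
import Data.Fin.Properties as Fin
open import Data.Fin.Subset
  using (Subset; inside; outside; ⊤; ⁅_⁆; _∈_; _⊆_; _∩_; ∁; ⋃; ∣_∣; Nonempty; Empty)
open import Data.Fin.Subset.Properties using (_∈?_; _⊆?_; nonempty?)
open import Data.Integer using (+_; -1ℤ)
import Data.Integer as ℤ
open import Data.List
  using (List; []; _∷_; _++_; map; foldr; filter; length; concatMap; cartesianProduct; tabulate; lookup)
open import Data.List.Properties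
  using (∷-injective; map-∘; map-cong; map-id; map-tabulate; length-tabulate; tabulate-lookup)
import Data.List.Relation.Binary.Subset.Propositional as List
import Data.List.Relation.Binary.Subset.DecPropositional as DecSubset
open import Data.List.Relation.Unary.All using (All; all?)
import Data.List.Relation.Unary.All as All
open import Data.List.Relation.Unary.AllPairs using (AllPairs)
open import Data.List.Relation.Unary.Any using (Any; any?)
open import Data.Nat using (ℕ; zero; suc; _∸_; _!; _≟_; _<_) renaming (_⊔_ to _⊔ℕ_)
import Data.Nat.Properties as ℕ
open import Data.Product using (∃; Σ; _×_; _,_; proj₁; proj₂)
open import Data.Rational using (ℚ; 0ℚ; 1ℚ; _/_)
import Data.Rational as ℚ
import Data.Rational.Properties as ℚ
open import Data.Vec using ([]; _∷_)
import Data.Vec.Properties as Vec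
open import Function using (_∘_; _↔_; Inverse)
open import Function.Bundles using (mk⇔)
open import Relation.Binary.PropositionalEquality using (_≡_; refl; sym; trans; cong; cong₂; subst)
open import Relation.Nullary using (Dec; yes; no; does)
open import Relation.Nullary.Decidable using (map′; _×-dec_; _→-dec_; does-⇔)

∑ : ∀ {a c ℓ} {A : Set a} (M : RawMonoid c ℓ) → List A → (A → RawMonoid.Carrier M) → RawMonoid.Carrier M
∑ M as f = foldr _∙_ ε (map f as)
  where open RawMonoid M

∑ℚ : ∀ {a} {A : Set a} → List A → (A → ℚ) → ℚ
∑ℚ = ∑ ℚ.+-0-rawMonoid

∏ℚ : ∀ {a} {A : Set a} → List A → (A → ℚ) → ℚ
∏ℚ = ∑ ℚ.*-1-rawMonoid

------------------------------------------------------------------------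
-- Set partitions

-- Fin n, in its usual order, plays the role of [n].  A collection of
-- subsets is a list, considered up to _≋_ (order and multiplicity of the
-- entries are immaterial).

Family : ℕ → Set
Family n = List (Subset n)

infix 4 _⊢_ _≋_ _≋?_ _≤_ _≤?_

-- Repeated blocks are ruled out by nonempty and disjoint together.
record _⊢_ {n} (π : Family n) (S : Subset n) : Set where
  field
    nonempty : All Nonempty π
    disjoint : AllPairs (λ A B → Empty (A ∩ B)) π
    union    : ⋃ π ≡ S

-- _≋_ and _≤_ only hold between families over the same ground set [n].

data _≋_ {n} (π : Family n) : ∀ {m} → Family m → Set where
  same : ∀ {ρ : Family n} → π List.⊆ ρ → ρ List.⊆ π → π ≋ ρ

data _≤_ {n} (σ : Family n) : ∀ {m} → Family m → Set where
  refines : ∀ {π : Family n} → All (λ A → Any (A ⊆_) π) σ → σ ≤ π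

ℓ : ∀ {n} → Family n → ℕ
ℓ = length

⟦_⟧ : ∀ n → Family n
⟦ n ⟧ = ⊤ ∷ []

infixl 8 _↾_
infixl 7 _⊍_

_↾_ : ∀ {n} → Family n → Subset n → Family n
π ↾ T = filter nonempty? (map (_∩ T) π)

_⊍_ : ∀ {n} → Family n → Family n → Family n
_⊍_ = _++_

-- The image of B ∩ S under the order-preserving bijection S → [∣S∣].
relabel : ∀ {n} (S : Subset n) → Subset n → Subset ∣ S ∣
relabel []            []      = []
relabel (inside  ∷ S) (b ∷ B) = b ∷ relabel S B
relabel (outside ∷ S) (_ ∷ B) = relabel S B

St : ∀ {n} (S : Subset n) → Family n → Family ∣ S ∣
St S = map (relabel S)

_≋?_ : ∀ {m n} (π : Family m) (ρ : Family n) → Dec (π ≋ ρ)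
_≋?_ {m} {n} π ρ with m ≟ n
... | no  m≢n = no λ { (same _ _) → m≢n refl }
... | yes refl with π DecSub.⊆? ρ | ρ DecSub.⊆? π
  where module DecSub = DecSubset (Vec.≡-dec {n = m} Bool._≟_)
...   | yes π⊆ρ | yes ρ⊆π = yes (same π⊆ρ ρ⊆π)
...   | no  π⊈ρ | _       = no λ { (same π⊆ρ _) → π⊈ρ π⊆ρ }
...   | _       | no  ρ⊈π = no λ { (same _ ρ⊆π) → ρ⊈π ρ⊆π }

_≤?_ : ∀ {m n} (σ : Family m) (π : Family n) → Dec (σ ≤ π)
_≤?_ {m} {n} σ π with m ≟ n
... | no  m≢n  = no λ { (refines _) → m≢n refl }
... | yes refl = map′ refines (λ { (refines r) → r })
                      (all? (λ A → any? (A ⊆?_) π) σ)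

subsets : ∀ n → List (Subset n)
subsets zero    = [] ∷ []
subsets (suc n) = map (outside ∷_) (subsets n) ++ map (inside ∷_) (subsets n)

decompositions : ∀ n → List (Subset n × Subset n)
decompositions n = map (λ S → S , ∁ S) (subsets n)

-- All ways of adding the new least element to one of the blocks.
insertions : ∀ {n} → Family n → List (Family (suc n))
insertions []      = []
insertions (B ∷ π) = ((inside ∷ B) ∷ map (outside ∷_) π)
                   ∷ map ((outside ∷ B) ∷_) (insertions π)

-- Every set partition of [n], listed exactly once up to _≋_: the new
-- element forms a block of its own or joins an existing block.
setPartitions : ∀ n → List (Family n)
setPartitions zero    = [] ∷ []
setPartitions (suc n) = concatMap extensions (setPartitions n)
  where
  extensions : Family n → List (Family (suc n))
  extensions π = (⁅ Fin.zero ⁆ ∷ map (outside ∷_) π) ∷ insertions π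

-- (-1)^(m-1) (m-1)!, used for m ≥ 1 only.
signedFactorial : ℕ → ℚ
signedFactorial m = (-1ℤ ℤ.^ (m ∸ 1) ℤ.* + ((m ∸ 1) !)) / 1

-- The Möbius function of the refinement order, for σ ≤ π.
u : ∀ {n} → Family n → Family n → ℚ
u σ π = ∏ℚ π λ B → signedFactorial (ℓ (filter (_⊆? B) σ))

------------------------------------------------------------------------
-- Symmetric functions in noncommuting variables

-- The variables are indexed by ℕ in place of the positive integers, a
-- monomial is the word of its indices, and a formal power series is the
-- function sending each monomial to its coefficient.  NCSym consists of
-- the series of bounded degree invariant under permuting the variables.
record NCSym : Set where
  field
    coeff     : List ℕ → ℚ
    degree    : ℕ
    bounded   : ∀ w → degree < length w → coeff w ≡ 0ℚ
    symmetric : ∀ (θ : ℕ ↔ ℕ) w → coeff (map (Inverse.to θ) w) ≡ coeff w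

open NCSym

infix 4 _≈_
record _≈_ (f g : NCSym) : Set where
  constructor mk≈
  field coeff-≡ : ∀ w → coeff f w ≡ coeff g w

open _≈_

private
  zeroˢ : NCSym
  zeroˢ = record
    { coeff     = λ _ → 0ℚ
    ; degree    = 0
    ; bounded   = λ _ _ → refl
    ; symmetric = λ _ _ → refl
    }

  addˢ : NCSym → NCSym → NCSym
  addˢ f g = record
    { coeff     = λ w → coeff f w ℚ.+ coeff g w
    ; degree    = degree f ⊔ℕ degree g
    ; bounded   = λ w d<w → cong₂ ℚ._+_
        (bounded f w (ℕ.≤-<-trans (ℕ.m≤m⊔n _ _) d<w))
        (bounded g w (ℕ.≤-<-trans (ℕ.m≤n⊔m (degree f) _) d<w))
    ; symmetric = λ θ w → cong₂ ℚ._+_ (symmetric f θ w) (symmetric g θ w)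
    }

  scaleˢ : ℚ → NCSym → NCSym
  scaleˢ q f = record
    { coeff     = λ w → q ℚ.* coeff f w
    ; degree    = degree f
    ; bounded   = λ w d<w → trans (cong (q ℚ.*_) (bounded f w d<w)) (ℚ.*-zeroʳ q)
    ; symmetric = λ θ w → cong (q ℚ.*_) (symmetric f θ w)
    }

  negˢ : NCSym → NCSym
  negˢ f = record
    { coeff     = λ w → ℚ.- coeff f w
    ; degree    = degree f
    ; bounded   = λ w d<w → cong ℚ.-_ (bounded f w d<w)
    ; symmetric = λ θ w → cong ℚ.-_ (symmetric f θ w)
    }

ncsym : LeftModule ℚ.+-*-ring 0ℓ 0ℓ
ncsym = record
  { Carrierᴹ = NCSym
  ; _≈ᴹ_     = _≈_
  ; _+ᴹ_     = addˢ
  ; _*ₗ_     = scaleˢ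
  ; 0ᴹ       = zeroˢ
  ; -ᴹ_      = negˢ
  ; isLeftModule = record
    { isLeftSemimodule = record
      { +ᴹ-isCommutativeMonoid = record
        { isMonoid = record
          { isSemigroup = record
            { isMagma = record
              { isEquivalence = record
                { refl  = mk≈ λ _ → refl
                ; sym   = λ p → mk≈ λ w → sym (coeff-≡ p w)
                ; trans = λ p q → mk≈ λ w → trans (coeff-≡ p w) (coeff-≡ q w)
                }
              ; ∙-cong = λ p q → mk≈ λ w → cong₂ ℚ._+_ (coeff-≡ p w) (coeff-≡ q w)
              }
            ; assoc = λ f g h → mk≈ λ w → ℚ.+-assoc (coeff f w) (coeff g w) (coeff h w)
            }
          ; identity = (λ f → mk≈ λ w → ℚ.+-identityˡ (coeff f w))
                     , (λ f → mk≈ λ w → ℚ.+-identityʳ (coeff f w))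
          }
        ; comm = λ f g → mk≈ λ w → ℚ.+-comm (coeff f w) (coeff g w)
        }
      ; isPreleftSemimodule = record
        { *ₗ-cong      = λ p q → mk≈ λ w → cong₂ ℚ._*_ p (coeff-≡ q w)
        ; *ₗ-zeroˡ     = λ f → mk≈ λ w → ℚ.*-zeroˡ (coeff f w)
        ; *ₗ-distribʳ  = λ f a b → mk≈ λ w → ℚ.*-distribʳ-+ (coeff f w) a b
        ; *ₗ-identityˡ = λ f → mk≈ λ w → ℚ.*-identityˡ (coeff f w)
        ; *ₗ-assoc     = λ a b f → mk≈ λ w → ℚ.*-assoc a b (coeff f w)
        ; *ₗ-zeroʳ     = λ a → mk≈ λ _ → ℚ.*-zeroʳ a
        ; *ₗ-distribˡ  = λ a f g → mk≈ λ w → ℚ.*-distribˡ-+ a (coeff f w) (coeff g w)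
        }
      }
    ; -ᴹ‿cong    = λ p → mk≈ λ w → cong ℚ.-_ (coeff-≡ p w)
    ; -ᴹ‿inverse = (λ f → mk≈ λ w → ℚ.+-inverseˡ (coeff f w))
                 , (λ f → mk≈ λ w → ℚ.+-inverseʳ (coeff f w))
    }
  }

ConstantOn : ∀ {n} → (Fin n → ℕ) → Subset n → Set
ConstantOn i B = ∀ j k → j ∈ B → k ∈ B → i j ≡ i k

OccursIn : ∀ {n} → List ℕ → Family n → Set
OccursIn {n} w π = Σ (Fin n → ℕ) λ i → w ≡ tabulate i × All (ConstantOn i) π

occursIn? : ∀ {n} (w : List ℕ) (π : Family n) → Dec (OccursIn w π)
occursIn? {n} w π with n ≟ length w
... | no  n≢ = no λ { (i , refl , _) → n≢ (sym (length-tabulate i)) }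
... | yes refl = map′
  (λ c → lookup w , sym (tabulate-lookup w) , c)
  (λ (i , w≡ , c) → All.map (λ c′ j k j∈ k∈ → trans (agree i w≡ j) (trans (c′ j k j∈ k∈) (sym (agree i w≡ k)))) c)
  (all? (λ B → Fin.all? λ j → Fin.all? λ k →
    (j ∈? B) →-dec ((k ∈? B) →-dec (lookup w j ≟ lookup w k))) π)
  where
  tabulate-injective : ∀ {m} (f g : Fin m → ℕ) → tabulate f ≡ tabulate g → ∀ j → f j ≡ g j
  tabulate-injective f g e Fin.zero    = proj₁ (∷-injective e)
  tabulate-injective f g e (Fin.suc j) = tabulate-injective (f ∘ Fin.suc) (g ∘ Fin.suc) (proj₂ (∷-injective e)) j

  agree : (i : Fin (length w) → ℕ) → w ≡ tabulate i → ∀ j → lookup w j ≡ i j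
  agree i w≡ = tabulate-injective (lookup w) i (trans (tabulate-lookup w) w≡)

private
  occursIn-map : ∀ {n} (f : ℕ → ℕ) w (π : Family n) → OccursIn w π → OccursIn (map f w) π
  occursIn-map f w π (i , refl , c) =
    f ∘ i , map-tabulate i f , All.map (λ c′ j k j∈ k∈ → cong f (c′ j k j∈ k∈)) c

-- A tuple i is determined by its monomial, so every monomial has
-- coefficient 1 or 0 in p π.
p : ∀ {n} → Family n → NCSym
p {n} π = record
  { coeff     = λ w → if does (occursIn? w π) then 1ℚ else 0ℚ
  ; degree    = n
  ; bounded   = bounded-p
  ; symmetric = λ θ w → cong (if_then 1ℚ else 0ℚ)
      (does-⇔ (mk⇔ (λ o → subst (λ v → OccursIn v π) (from-to θ w)
                             (occursIn-map (Inverse.from θ) _ π o))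
                   (occursIn-map (Inverse.to θ) w π))
              (occursIn? _ π) (occursIn? w π))
  }
  where
  from-to : ∀ (θ : ℕ ↔ ℕ) w → map (Inverse.from θ) (map (Inverse.to θ) w) ≡ w
  from-to θ w = trans (sym (map-∘ w))
    (trans (map-cong (Inverse.strictlyInverseʳ θ) w) (map-id w))

  bounded-p : ∀ w → n < length w → (if does (occursIn? w π) then 1ℚ else 0ℚ) ≡ 0ℚ
  bounded-p w n<w with occursIn? w π
  ... | no  _              = refl
  ... | yes (i , refl , _) with () ← ℕ.<-irrefl (sym (length-tabulate i)) n<w

x : ∀ {n} → Family n → NCSym
x {n} π = ∑ +ᴹ-rawMonoid (filter (_≤? π) (setPartitions n)) λ σ → u σ π *ₗ p σ
  where open LeftModule ncsym

------------------------------------------------------------------------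
-- Tensor products

-- M ⊗ N by generators and relations: formal expressions in pure tensors,
-- modulo the least congruence containing the module axioms and bilinearity.
module TensorProduct {r ℓr m ℓm n ℓn : Level} (R : CommutativeRing r ℓr)
  (M : LeftModule (CommutativeRing.ring R) m ℓm)
  (N : LeftModule (CommutativeRing.ring R) n ℓn) where

  private
    module R = CommutativeRing R
    module M = LeftModule M
    module N = LeftModule N

  infixr 9 _⊗_
  infixr 8 -ᵗ_
  infixr 7 _*ᵗ_
  infixl 6 _+ᵗ_
  infix 4 _≈ᵗ_

  data Tensor : Set (r ⊔ m ⊔ n) where
    _⊗_  : M.Carrierᴹ → N.Carrierᴹ → Tensor
    0ᵗ   : Tensor
    _+ᵗ_ : Tensor → Tensor → Tensor
    -ᵗ_  : Tensor → Tensor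
    _*ᵗ_ : R.Carrier → Tensor → Tensor

  data _≈ᵗ_ : Tensor → Tensor → Set (r ⊔ ℓr ⊔ m ⊔ ℓm ⊔ n ⊔ ℓn) where
    reflᵗ  : ∀ {s} → s ≈ᵗ s
    symᵗ   : ∀ {s t} → s ≈ᵗ t → t ≈ᵗ s
    transᵗ : ∀ {s t v} → s ≈ᵗ t → t ≈ᵗ v → s ≈ᵗ v

    +-cong : ∀ {s s′ t t′} → s ≈ᵗ s′ → t ≈ᵗ t′ → s +ᵗ t ≈ᵗ s′ +ᵗ t′
    -‿cong : ∀ {s t} → s ≈ᵗ t → -ᵗ s ≈ᵗ -ᵗ t
    *-cong : ∀ {a b s t} → a R.≈ b → s ≈ᵗ t → a *ᵗ s ≈ᵗ b *ᵗ t

    +-assoc     : ∀ s t v → (s +ᵗ t) +ᵗ v ≈ᵗ s +ᵗ (t +ᵗ v)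
    +-comm      : ∀ s t → s +ᵗ t ≈ᵗ t +ᵗ s
    +-identityˡ : ∀ s → 0ᵗ +ᵗ s ≈ᵗ s
    -‿inverseˡ  : ∀ s → (-ᵗ s) +ᵗ s ≈ᵗ 0ᵗ
    *-identityˡ : ∀ s → R.1# *ᵗ s ≈ᵗ s
    *-assoc     : ∀ a b s → (a R.* b) *ᵗ s ≈ᵗ a *ᵗ (b *ᵗ s)
    *-distribˡ  : ∀ a s t → a *ᵗ (s +ᵗ t) ≈ᵗ a *ᵗ s +ᵗ a *ᵗ t
    *-distribʳ  : ∀ s a b → (a R.+ b) *ᵗ s ≈ᵗ a *ᵗ s +ᵗ b *ᵗ s
    *-zeroˡ     : ∀ s → R.0# *ᵗ s ≈ᵗ 0ᵗ
    *-zeroʳ     : ∀ a → a *ᵗ 0ᵗ ≈ᵗ 0ᵗ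

    ⊗-cong     : ∀ {f f′ g g′} → f M.≈ᴹ f′ → g N.≈ᴹ g′ → f ⊗ g ≈ᵗ f′ ⊗ g′
    ⊗-distribʳ : ∀ f f′ g → (f M.+ᴹ f′) ⊗ g ≈ᵗ f ⊗ g +ᵗ f′ ⊗ g
    ⊗-distribˡ : ∀ f g g′ → f ⊗ (g N.+ᴹ g′) ≈ᵗ f ⊗ g +ᵗ f ⊗ g′
    ⊗-scaleˡ   : ∀ a f g → (a M.*ₗ f) ⊗ g ≈ᵗ a *ᵗ f ⊗ g
    ⊗-scaleʳ   : ∀ a f g → f ⊗ (a N.*ₗ g) ≈ᵗ a *ᵗ f ⊗ g

  tensorProduct : LeftModule R.ring (r ⊔ m ⊔ n) (r ⊔ ℓr ⊔ m ⊔ ℓm ⊔ n ⊔ ℓn)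
  tensorProduct = record
    { Carrierᴹ = Tensor
    ; _≈ᴹ_     = _≈ᵗ_
    ; _+ᴹ_     = _+ᵗ_
    ; _*ₗ_     = _*ᵗ_
    ; 0ᴹ       = 0ᵗ
    ; -ᴹ_      = -ᵗ_
    ; isLeftModule = record
      { isLeftSemimodule = record
        { +ᴹ-isCommutativeMonoid = record
          { isMonoid = record
            { isSemigroup = record
              { isMagma = record
                { isEquivalence = record { refl = reflᵗ ; sym = symᵗ ; trans = transᵗ }
                ; ∙-cong = +-cong
                }
              ; assoc = +-assoc
              }
            ; identity = +-identityˡ , λ s → transᵗ (+-comm s 0ᵗ) (+-identityˡ s)
            }
          ; comm = +-comm
          }
        ; isPreleftSemimodule = record
          { *ₗ-cong      = *-cong
          ; *ₗ-zeroˡ     = *-zeroˡ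
          ; *ₗ-distribʳ  = *-distribʳ
          ; *ₗ-identityˡ = *-identityˡ
          ; *ₗ-assoc     = *-assoc
          ; *ₗ-zeroʳ     = *-zeroʳ
          ; *ₗ-distribˡ  = *-distribˡ
          }
        }
      ; -ᴹ‿cong    = -‿cong
      ; -ᴹ‿inverse = -‿inverseˡ , λ s → transᵗ (+-comm s (-ᵗ s)) (-‿inverseˡ s)
      }
    }

open TensorProduct ℚ.+-*-commutativeRing ncsym ncsym public using (Tensor; _⊗_)

ncsym⊗ncsym : LeftModule ℚ.+-*-ring 0ℓ 0ℓ
ncsym⊗ncsym = TensorProduct.tensorProduct ℚ.+-*-commutativeRing ncsym ncsym

∑⊗ : ∀ {a} {A : Set a} → List A → (A → Tensor) → Tensor
∑⊗ = ∑ (LeftModule.+ᴹ-rawMonoid ncsym⊗ncsym)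

------------------------------------------------------------------------
-- The coproduct, and expansions in the tensors x α ⊗ x β

Splits : ∀ {n} → Family n → Subset n × Subset n → Set
Splits π (S₁ , S₂) = π ≋ π ↾ S₁ ⊍ π ↾ S₂

splits? : ∀ {n} (π : Family n) S → Dec (Splits π S)
splits? π (S₁ , S₂) = π ≋? (π ↾ S₁ ⊍ π ↾ S₂)

open LeftModule ncsym⊗ncsym using (_*ₗ_) renaming (_≈ᴹ_ to _≈⊗_)

-- These properties determine Δ, since the p π span NCSym.
record IsCoproduct (Δ : NCSym → Tensor) : Set where
  open LeftModuleMorphisms (LeftModule.rawLeftModule ncsym) (LeftModule.rawLeftModule ncsym⊗ncsym)
  field
    linear : IsLeftModuleHomomorphism Δ
    Δ-p    : ∀ {n} (π : Family n) → π ⊢ ⊤ →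
             Δ (p π) ≈⊗ ∑⊗ (filter (splits? π) (decompositions n))
                           λ (S₁ , S₂) → p (St S₁ (π ↾ S₁)) ⊗ p (St S₂ (π ↾ S₂))

record SetPartition : Set where
  field
    {size}      : ℕ
    blocks      : Family size
    isPartition : blocks ⊢ ⊤

open SetPartition

Expansion : Set
Expansion = List (ℚ × SetPartition × SetPartition)

combination : Expansion → Tensor
combination e = ∑⊗ e λ (q , α , β) → q *ₗ (x (blocks α) ⊗ x (blocks β))

-- The same pair (α , β) may occur several times in an expansion.
coefficient : ∀ {k l} → Family k → Family l → Expansion → ℚ
coefficient σ τ e =
  ∑ℚ (filter (λ (_ , α , β) → (blocks α ≋? σ) ×-dec (blocks β ≋? τ)) e) proj₁

-- t is a finite linear combination of tensors x α ⊗ x β, and in every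
-- such expression of t the tensor x σ ⊗ x τ has coefficient c.
record HasCoefficient {k l} (t : Tensor) (σ : Family k) (τ : Family l) (c : ℚ) : Set where
  field
    expansion : ∃ λ e → t ≈⊗ combination e
    unique    : ∀ e → t ≈⊗ combination e → coefficient σ τ e ≡ c

Admissible : ∀ {n k l} → Family k → Family l → Family n × Subset n × Subset n → Set
Admissible σ τ (ν , S₁ , S₂) =
  Splits ν (S₁ , S₂) × σ ≤ St S₁ (ν ↾ S₁) × τ ≤ St S₂ (ν ↾ S₂)

admissible? : ∀ {n k l} (σ : Family k) (τ : Family l) (t : Family n × Subset n × Subset n) →
              Dec (Admissible σ τ t)
admissible? σ τ (ν , S₁ , S₂) =
  splits? ν (S₁ , S₂) ×-dec (σ ≤? St S₁ (ν ↾ S₁)) ×-dec (τ ≤? St S₂ (ν ↾ S₂))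

triples : ∀ {k l} n → Family k → Family l → List (Family n × Subset n × Subset n)
triples n σ τ = filter (admissible? σ τ) (cartesianProduct (setPartitions n) (decompositions n))

{-# OPTIONS --safe #-}

-- Removing the least element from partitions σ ≤ α ≤ π shows ∑ u(α,π) = [σ = π]: if it is
-- alone in σ but not in π, then adjoining it to α as a new block multiplies u(α,π) by -m, where
-- m is the number of blocks of α it could join, and each of those m joins leaves u(α,π)
-- unchanged.  Hence a functional with p_π ↦ [σ ≤ π] for all π reads off the coefficient of x_σ.
-- It exists on NCSym because a word with kernel ρ has coefficient [π ≤ ρ] in p_π, so a second
-- Möbius inversion expresses it through coefficients of words.  Tensor products of two such
-- functionals respect the relations of NCSym ⊗ NCSym, which makes the coefficient of x_σ ⊗ x_τ
-- unique and computes it on Δ(x_[n]).  An expansion exists since x_π is p_π plus a combination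
-- of p_σ with σ < π.

module Submission where

open import Defs
open import Algebra.Bundles using (CommutativeMonoid; Monoid)
open import Algebra.Module.Bundles using (LeftModule)
open import Algebra.Module.Morphism.Structures using (module LeftModuleMorphisms)
import Algebra.Properties.CommutativeSemigroup as CommutativeSemigroupProperties
open import Data.Bool using (if_then_else_)
open import Data.Fin using (Fin; zero; suc)
import Data.Fin.Properties as Fin
open import Data.Fin.Subset
  using (Subset; inside; outside; ⊤; ⁅_⁆; _∈_; _⊆_; _∩_; ⋃; ∣_∣; Nonempty; Empty)
open import Data.Fin.Subset.Properties
open import Data.Integer as ℤ using (-1ℤ) renaming (+_ to infix 8 pos_)
import Data.Integer.Properties as ℤ
open import Data.List
  using (List; []; _∷_; _++_; map; filter; concatMap; length; tabulate; cartesianProduct)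
open import Data.List.Membership.Propositional using () renaming (_∈_ to _∈ᴸ_)
import Data.List.Membership.Propositional as List
open import Data.List.Membership.Propositional.Properties
  using (∈-concatMap⁻; ∈-map⁻; ∈-map⁺; ∈-filter⁺; ∈-filter⁻)
open import Data.List.Properties
  using (∷-injective; length-tabulate; filter-none; filter-all; filter-accept; filter-reject)
open import Data.List.Relation.Unary.All as All using (All; []; _∷_)
import Data.List.Relation.Unary.All.Properties as All
open import Data.List.Relation.Unary.AllPairs as AllPairs using (AllPairs; []; _∷_)
import Data.List.Relation.Unary.AllPairs.Properties as AllPairs
open import Data.List.Relation.Unary.Any as Any using (Any; here; there; any?)
import Data.List.Relation.Unary.Any.Properties as Any
open import Data.Nat as ℕ using (ℕ; zero; suc; _≥_; _!)
open import Data.Nat.Induction using (<-wellFounded)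
import Data.Nat.Properties as ℕ
open import Data.Product using (∃; ∃₂; _×_; _,_; proj₁; proj₂; map₁; map₂; swap)
open import Data.Rational as ℚ using (ℚ; 0ℚ; 1ℚ; _+_; _*_; _/_)
import Data.Rational.Properties as ℚ
open import Data.Rational.Unnormalised as ℚᵘ using (mkℚᵘ; *≡*)
import Data.Rational.Unnormalised.Properties as ℚᵘ
open import Data.Sum using (inj₁; inj₂)
open import Data.Vec using ([]; _∷_; here; there)
open import Function using (_∘_; _⇔_; mk⇔; module Equivalence)
open import Induction.WellFounded using (Acc; acc)
open import Level using (0ℓ)
open import Relation.Binary using (Rel; IsEquivalence; Decidable)
open import Relation.Binary.PropositionalEquality
open import Relation.Nullary using (Dec; yes; no; does; ¬_; contradiction)
open import Relation.Nullary.Decidable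
  using (does-⇔; dec-true; dec-false; _×-dec_; _→-dec_; ¬?)
import Relation.Unary as U

open Equivalence using (to; from)

-- A linear map out of `NCSym` cannot simply be prescribed on the `p π`: an element is a series, and
-- no expansion in the `p π` comes with it. Reading off the coefficient of a word is linear by
-- construction, so every functional here is a finite combination of such readings. The tensor
-- product is likewise known only through its relations, so distinct coefficients can be told apart
-- only by a map out of it. The order in which a list names the blocks has no meaning, so partitions
-- are compared through the relation of lying in a common block. Restricting that relation along
-- `suc` deletes the least element, and one induction step then serves two sums: with weight 1 it
-- counts the entries of `setPartitions` equal to a given partition, and with weight `u` it gives
-- the Möbius sum.

private
  module +ℚ = CommutativeSemigroupProperties (CommutativeMonoid.commutativeSemigroup ℚ.+-0-commutativeMonoid)
  module *ℚ = CommutativeSemigroupProperties (CommutativeMonoid.commutativeSemigroup ℚ.*-1-commutativeMonoid)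

private variable
  k m n : ℕ

-- Finite sums

module _ {c e} (M : Monoid c e) where
  open Monoid M renaming (_≈_ to _≃_; refl to ≃-refl; sym to ≃-sym; trans to ≃-trans)

  ∑-++ : ∀ {a} {A : Set a} (as bs : List A) (f : A → Carrier) →
         ∑ rawMonoid (as ++ bs) f ≃ ∑ rawMonoid as f ∙ ∑ rawMonoid bs f
  ∑-++ []       bs f = ≃-sym (identityˡ _)
  ∑-++ (a ∷ as) bs f = ≃-trans (∙-congˡ (∑-++ as bs f)) (≃-sym (assoc _ _ _))

  ∑-cong : ∀ {a} {A : Set a} (as : List A) {f g : A → Carrier} →
           (∀ {a} → a ∈ᴸ as → f a ≃ g a) → ∑ rawMonoid as f ≃ ∑ rawMonoid as g
  ∑-cong []       f≃g = ≃-refl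
  ∑-cong (a ∷ as) f≃g = ∙-cong (f≃g (here refl)) (∑-cong as (f≃g ∘ there))

  ∑-map : ∀ {a b} {A : Set a} {B : Set b} (h : A → B) (as : List A) (f : B → Carrier) →
          ∑ rawMonoid (map h as) f ≃ ∑ rawMonoid as (f ∘ h)
  ∑-map h []       f = ≃-refl
  ∑-map h (a ∷ as) f = ∙-congˡ (∑-map h as f)

  ∑-concatMap : ∀ {a b} {A : Set a} {B : Set b} (h : A → List B) (as : List A) (f : B → Carrier) →
                ∑ rawMonoid (concatMap h as) f ≃ ∑ rawMonoid as (λ a → ∑ rawMonoid (h a) f)
  ∑-concatMap h []       f = ≃-refl
  ∑-concatMap h (a ∷ as) f = ≃-trans (∑-++ (h a) _ f) (∙-congˡ (∑-concatMap h as f))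

  ∑-cartesianProduct : ∀ {a b} {A : Set a} {B : Set b} (as : List A) (bs : List B) (f : A × B → Carrier) →
    ∑ rawMonoid (cartesianProduct as bs) f ≃ ∑ rawMonoid as (λ a → ∑ rawMonoid bs (λ b → f (a , b)))
  ∑-cartesianProduct []       bs f = ≃-refl
  ∑-cartesianProduct (a ∷ as) bs f =
    ≃-trans (∑-++ (map (a ,_) bs) _ f) (∙-cong (∑-map (a ,_) bs f) (∑-cartesianProduct as bs f))

module _ {a} {A : Set a} where

  ∑ℚ-cong : (as : List A) {f g : A → ℚ} → (∀ {a} → a ∈ᴸ as → f a ≡ g a) → ∑ℚ as f ≡ ∑ℚ as g
  ∑ℚ-cong = ∑-cong ℚ.+-0-monoid

  ∑ℚ-zero : (as : List A) {f : A → ℚ} → (∀ {a} → a ∈ᴸ as → f a ≡ 0ℚ) → ∑ℚ as f ≡ 0ℚ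
  ∑ℚ-zero []       f≡0 = refl
  ∑ℚ-zero (a ∷ as) f≡0 = cong₂ _+_ (f≡0 (here refl)) (∑ℚ-zero as (f≡0 ∘ there))

  *-∑ℚ : (c : ℚ) (as : List A) (f : A → ℚ) → c * ∑ℚ as f ≡ ∑ℚ as (λ a → c * f a)
  *-∑ℚ c []       f = ℚ.*-zeroʳ c
  *-∑ℚ c (a ∷ as) f = trans (ℚ.*-distribˡ-+ c _ _) (cong (c * f a +_) (*-∑ℚ c as f))

  ∑ℚ-* : (as : List A) (f : A → ℚ) (c : ℚ) → ∑ℚ as f * c ≡ ∑ℚ as (λ a → f a * c)
  ∑ℚ-* as f c = trans (ℚ.*-comm _ c) (trans (*-∑ℚ c as f) (∑ℚ-cong as λ {a} _ → ℚ.*-comm c (f a)))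

  ∑ℚ-+ : (as : List A) (f g : A → ℚ) → ∑ℚ as (λ a → f a + g a) ≡ ∑ℚ as f + ∑ℚ as g
  ∑ℚ-+ []       f g = refl
  ∑ℚ-+ (a ∷ as) f g =
    trans (cong (f a + g a +_) (∑ℚ-+ as f g)) (+ℚ.interchange (f a) (g a) _ _)

-- The same expression as in the definition of `p`, so that `coeff (p π) w` is by computation the
-- indicator of `occursIn? w π`.
𝟙 : ∀ {a} {A : Set a} → Dec A → ℚ
𝟙 a? = if does a? then 1ℚ else 0ℚ

module _ {a} {A : Set a} where

  𝟙-true : (a? : Dec A) → A → 𝟙 a? ≡ 1ℚ
  𝟙-true a? a = cong (if_then 1ℚ else 0ℚ) (dec-true a? a)

  𝟙-false : (a? : Dec A) → ¬ A → 𝟙 a? ≡ 0ℚ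
  𝟙-false a? ¬a = cong (if_then 1ℚ else 0ℚ) (dec-false a? ¬a)

  𝟙-cong : ∀ {b} {B : Set b} → A ⇔ B → (a? : Dec A) (b? : Dec B) → 𝟙 a? ≡ 𝟙 b?
  𝟙-cong A⇔B a? b? = cong (if_then 1ℚ else 0ℚ) (does-⇔ A⇔B a? b?)

  𝟙-× : ∀ {b} {B : Set b} (a? : Dec A) (b? : Dec B) → 𝟙 (a? ×-dec b?) ≡ 𝟙 a? * 𝟙 b?
  𝟙-× (yes _) (yes _) = refl
  𝟙-× (yes _) (no  _) = refl
  𝟙-× (no  _) b?      = sym (ℚ.*-zeroˡ (𝟙 b?))

  𝟙*-cong : (a? : Dec A) {q r : ℚ} → (A → q ≡ r) → 𝟙 a? * q ≡ 𝟙 a? * r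
  𝟙*-cong (yes a) q≡r = cong (1ℚ *_) (q≡r a)
  𝟙*-cong (no  _) {q} {r} q≡r = trans (ℚ.*-zeroˡ q) (sym (ℚ.*-zeroˡ r))

  -- Filtered sums become full sums with indicator weights, so that conditions can be split,
  -- exchanged and factored out by ring arithmetic.
  ∑ℚ-filter : ∀ {p} {P : A → Set p} (P? : U.Decidable P) (as : List A) (f : A → ℚ) →
              ∑ℚ (filter P? as) f ≡ ∑ℚ as (λ a → 𝟙 (P? a) * f a)
  ∑ℚ-filter P? []       f = refl
  ∑ℚ-filter P? (a ∷ as) f with P? a
  ... | yes _ = cong₂ _+_ (sym (ℚ.*-identityˡ (f a))) (∑ℚ-filter P? as f)
  ... | no  _ = trans (∑ℚ-filter P? as f)
                  (sym (trans (cong (_+ _) (ℚ.*-zeroˡ (f a))) (ℚ.+-identityˡ _)))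

-- Partitions and their extensions by a new least element

Disjoint : Family n → Set
Disjoint = AllPairs (λ A B → Empty (A ∩ B))

Covering : Family n → Set
Covering π = ∀ i → Any (i ∈_) π

∈-⋃⁻ : ∀ (π : Family n) {i} → i ∈ ⋃ π → Any (i ∈_) π
∈-⋃⁻ []      i∈ = contradiction i∈ ∉⊥
∈-⋃⁻ (A ∷ π) i∈ with x∈p∪q⁻ A (⋃ π) i∈
... | inj₁ i∈A = here i∈A
... | inj₂ i∈⋃ = there (∈-⋃⁻ π i∈⋃)

∈-⋃⁺ : ∀ {π : Family n} {i} → Any (i ∈_) π → i ∈ ⋃ π
∈-⋃⁺ (here i∈A) = x∈p∪q⁺ (inj₁ i∈A)
∈-⋃⁺ (there i∈) = x∈p∪q⁺ (inj₂ (∈-⋃⁺ i∈))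

covering : ∀ {π : Family n} → π ⊢ ⊤ → Covering π
covering {π = π} π⊢ i = ∈-⋃⁻ π (subst (i ∈_) (sym (_⊢_.union π⊢)) ∈⊤)

covering⁻ : ∀ {π : Family n} → Covering π → ⋃ π ≡ ⊤
covering⁻ {π = π} c = ⊆-antisym ⊆⊤ λ {i} _ → ∈-⋃⁺ (c i)

-- Empty blocks may occur, even repeatedly: they arise when the least element is deleted from all
-- blocks, and as signedFactorial 0 ≡ 1 they do not affect u.
record IsWeakPartition (π : Family n) : Set where
  constructor weak
  field
    disjoint : Disjoint π
    covers   : Covering π

open IsWeakPartition

⊢⇒weak : ∀ {π : Family n} → π ⊢ ⊤ → IsWeakPartition π
⊢⇒weak π⊢ = weak (_⊢_.disjoint π⊢) (covering π⊢)

disjoint⇒≡ : ∀ {π : Family n} → Disjoint π → ∀ {A B i} → A ∈ᴸ π → B ∈ᴸ π → i ∈ A → i ∈ B → A ≡ B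
disjoint⇒≡ (_ ∷ _) (here refl) (here refl) _ _ = refl
disjoint⇒≡ (d ∷ _) (here refl) (there B∈) i∈A i∈B = contradiction (_ , x∈p∩q⁺ (i∈A , i∈B)) (All.lookup d B∈)
disjoint⇒≡ (d ∷ _) (there A∈) (here refl) i∈A i∈B = contradiction (_ , x∈p∩q⁺ (i∈B , i∈A)) (All.lookup d A∈)
disjoint⇒≡ (_ ∷ d) (there A∈) (there B∈) = disjoint⇒≡ d A∈ B∈

-- This relation forgets the order and repetition of blocks as well as empty blocks, so that
-- refinement becomes inclusion of relations.
Together : Family n → Rel (Fin n) 0ℓ
Together π i j = Any (λ A → i ∈ A × j ∈ A) π

together? : (π : Family n) → Decidable (Together π)
together? π i j = any? (λ A → (i ∈? A) ×-dec (j ∈? A)) π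

together : ∀ {π : Family n} {A i j} → A ∈ᴸ π → i ∈ A → j ∈ A → Together π i j
together A∈π i∈A j∈A = List.lose A∈π (i∈A , j∈A)

together⁻ : ∀ {π : Family n} {A i j} → Disjoint π → A ∈ᴸ π → i ∈ A → Together π i j → j ∈ A
together⁻ d A∈π i∈A i~j with B , B∈π , i∈B , j∈B ← List.find i~j =
  subst (_ ∈_) (disjoint⇒≡ d B∈π A∈π i∈B i∈A) j∈B

block : ∀ {π : Family n} → IsWeakPartition π → ∀ i → ∃ λ A → A ∈ᴸ π × i ∈ A
block w i = List.find (covers w i)

together-equivalence : ∀ {π : Family n} → IsWeakPartition π → IsEquivalence (Together π)
together-equivalence w = record
  { refl  = λ {i} → Any.map (λ i∈ → i∈ , i∈) (covers w i)
  ; sym   = Any.map λ (i∈ , j∈) → j∈ , i∈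
  ; trans = λ i~j j~k → let _ , A∈π , i∈ , j∈ = List.find i~j in
                        together A∈π i∈ (together⁻ (disjoint w) A∈π j∈ j~k)
  }

infix 4 _⇛_

_⇛_ : Rel (Fin n) 0ℓ → Rel (Fin n) 0ℓ → Set
S ⇛ T = ∀ i j → S i j → T i j

⇛? : {S T : Rel (Fin n) 0ℓ} → Decidable S → Decidable T → Dec (S ⇛ T)
⇛? S? T? = Fin.all? λ i → Fin.all? λ j → S? i j →-dec T? i j

-- The bounds are relations and not families: deleting the least element from them is then mere
-- restriction, with no list of blocks to rebuild.
Between : Rel (Fin n) 0ℓ → Family n → Rel (Fin n) 0ℓ → Set
Between S α T = (S ⇛ Together α) × (Together α ⇛ T)

between? : {S T : Rel (Fin n) 0ℓ} → Decidable S → (α : Family n) → Decidable T → Dec (Between S α T)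
between? S? α T? = ⇛? S? (together? α) ×-dec ⇛? (together? α) T?

alone : Family n → Family (suc n)
alone α = ⁅ zero ⁆ ∷ map (outside ∷_) α

-- Records which block receives the new element, information that the list `insertions` drops. It is
-- also read backwards, as the deletion of the least element from a given partition.
data Insertion : Subset n → Family n → Family (suc n) → Set where
  here  : ∀ {A} {α : Family n} → Insertion A (A ∷ α) ((inside ∷ A) ∷ map (outside ∷_) α)
  there : ∀ {A B} {α : Family n} {β} → Insertion A α β → Insertion A (B ∷ α) ((outside ∷ B) ∷ β)

insertion-∈ : ∀ {A} {α : Family n} {β} → Insertion A α β → A ∈ᴸ α
insertion-∈ here      = here refl
insertion-∈ (there I) = there (insertion-∈ I)

∈-insertions : ∀ (α : Family n) {β} → β ∈ᴸ insertions α → ∃ λ A → Insertion A α β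
∈-insertions (A ∷ α) (here refl) = A , here
∈-insertions (B ∷ α) (there β∈) with γ , γ∈ , refl ← ∈-map⁻ ((outside ∷ B) ∷_) β∈ =
  let A , I = ∈-insertions α γ∈ in A , there I

together-outside : ∀ {α : Family n} {i j} → Together (map (outside ∷_) α) (suc i) (suc j) ⇔ Together α i j
together-outside = mk⇔ (Any.map (λ (p , q) → drop-there p , drop-there q) ∘ Any.map⁻)
                       (Any.map⁺ ∘ Any.map (λ (p , q) → there p , there q))

¬together-outside : ∀ {α : Family n} {j} → ¬ Together (map (outside ∷_) α) zero j
¬together-outside t with Any.satisfied (Any.map⁻ t)
... | _ , () , _

module _ {α : Family n} where

  alone-suc : ∀ {i j} → Together (alone α) (suc i) (suc j) ⇔ Together α i j
  alone-suc = mk⇔ (λ { (here (there i∈ , _)) → contradiction i∈ ∉⊥ ; (there t) → to (together-outside {α = α}) t })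
                  (there ∘ from (together-outside {α = α}))

  alone-zero : ∀ {j} → ¬ Together (alone α) zero (suc j)
  alone-zero (here (_ , there j∈)) = ∉⊥ j∈
  alone-zero (there t) = ¬together-outside {α = α} t

insertion-suc : ∀ {A} {α : Family n} {β} → Insertion A α β →
                ∀ {i j} → Together β (suc i) (suc j) ⇔ Together α i j
insertion-suc {α = A ∷ α} here = mk⇔
  (λ { (here (there p , there q)) → here (p , q) ; (there t) → there (to (together-outside {α = α}) t) })
  (λ { (here (p , q)) → here (there p , there q) ; (there t) → there (from (together-outside {α = α}) t) })
insertion-suc (there I) = mk⇔
  (λ { (here (there p , there q)) → here (p , q) ; (there t) → there (to (insertion-suc I) t) })
  (λ { (here (p , q)) → here (there p , there q) ; (there t) → there (from (insertion-suc I) t) })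

insertion-zero : ∀ {A} {α : Family n} {β} → Insertion A α β → ∀ {j} → Together β zero (suc j) ⇔ j ∈ A
insertion-zero {α = A ∷ α} here = mk⇔
  (λ { (here (_ , there q)) → q ; (there t) → contradiction t (¬together-outside {α = α}) })
  (λ q → here (here , there q))
insertion-zero (there I) = mk⇔
  (λ { (here (() , _)) ; (there t) → to (insertion-zero I) t })
  (there ∘ from (insertion-zero I))

outside-disjoint : ∀ {α : Family n} → Disjoint α → Disjoint (map (outside ∷_) α)
outside-disjoint = AllPairs.map⁺ ∘ AllPairs.map λ { d (suc i , there i∈) → d (i , i∈) }

inside-disjoint : ∀ {A} {α : Family n} → All (λ B → Empty (A ∩ B)) α →
                  All (λ B → Empty ((inside ∷ A) ∩ B)) (map (outside ∷_) α)
inside-disjoint = All.map⁺ ∘ All.map λ { d (suc i , there i∈) → d (i , i∈) }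

insertion-disjoint : ∀ {A} {α : Family n} {β} → Insertion A α β → Disjoint α → Disjoint β
insertion-disjoint here      (d ∷ ds) = inside-disjoint d ∷ outside-disjoint ds
insertion-disjoint (there I) (d ∷ ds) = go I d ∷ insertion-disjoint I ds
  where
  go : ∀ {A B} {α : Family n} {β} → Insertion A α β →
       All (λ C → Empty (B ∩ C)) α → All (λ C → Empty ((outside ∷ B) ∩ C)) β
  go here      (d ∷ ds) = (λ { (suc i , there i∈) → d (i , i∈) }) ∷
                     All.map⁺ (All.map (λ { d (suc i , there i∈) → d (i , i∈) }) ds)
  go (there I) (d ∷ ds) = (λ { (suc i , there i∈) → d (i , i∈) }) ∷ go I ds

outside-nonempty : ∀ {α : Family n} → All Nonempty α → All Nonempty (map (outside ∷_) α)
outside-nonempty = All.map⁺ ∘ All.map λ (i , i∈) → suc i , there i∈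

insertion-nonempty : ∀ {A} {α : Family n} {β} → Insertion A α β → All Nonempty α → All Nonempty β
insertion-nonempty here      (_ ∷ ne) = (zero , here) ∷ outside-nonempty ne
insertion-nonempty (there I) ((i , i∈) ∷ ne) = (suc i , there i∈) ∷ insertion-nonempty I ne

outside-covers : ∀ {α : Family n} {i} → Any (i ∈_) α → Any (suc i ∈_) (map (outside ∷_) α)
outside-covers = Any.map⁺ ∘ Any.map there

insertion-covers-zero : ∀ {A} {α : Family n} {β} → Insertion A α β → Any (zero ∈_) β
insertion-covers-zero here      = here here
insertion-covers-zero (there I) = there (insertion-covers-zero I)

insertion-covers-suc : ∀ {A} {α : Family n} {β i} → Insertion A α β → Any (i ∈_) α → Any (suc i ∈_) β
insertion-covers-suc here      (here i∈)  = here (there i∈)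
insertion-covers-suc here      (there i∈) = there (outside-covers i∈)
insertion-covers-suc (there I) (here i∈)  = here (there i∈)
insertion-covers-suc (there I) (there i∈) = there (insertion-covers-suc I i∈)

insertion-covers : ∀ {A} {α : Family n} {β} → Insertion A α β → Covering α → Covering β
insertion-covers I c zero    = insertion-covers-zero I
insertion-covers I c (suc i) = insertion-covers-suc I (c i)

setPartitions-⊢ : ∀ n {α} → α ∈ᴸ setPartitions n → α ⊢ ⊤
setPartitions-⊢ zero    (here refl) = record { nonempty = [] ; disjoint = [] ; union = refl }
setPartitions-⊢ (suc n) β∈ with List.find (∈-concatMap⁻ _ {xs = setPartitions n} β∈)
... | α , α∈ , here refl = record
  { nonempty = (zero , here) ∷ outside-nonempty (_⊢_.nonempty α⊢)
  ; disjoint = All.map⁺ (All.tabulate λ { _ (suc i , there i∈) → ∉⊥ (proj₁ (x∈p∩q⁻ _ _ i∈)) })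
             ∷ outside-disjoint (_⊢_.disjoint α⊢)
  ; union    = covering⁻ λ { zero → here here ; (suc i) → there (outside-covers (covering α⊢ i)) }
  }
  where α⊢ = setPartitions-⊢ n α∈
... | α , α∈ , there β∈′ = record
  { nonempty = insertion-nonempty (proj₂ I) (_⊢_.nonempty α⊢)
  ; disjoint = insertion-disjoint (proj₂ I) (_⊢_.disjoint α⊢)
  ; union    = covering⁻ (insertion-covers (proj₂ I) (covering α⊢))
  }
  where
  α⊢ = setPartitions-⊢ n α∈
  I = ∈-insertions α β∈′

-- Signed factorials and counting by indicators

/1-homo-+ : ∀ i j → (i ℤ.+ j) / 1 ≡ i / 1 + j / 1
/1-homo-+ i j = ℚ.toℚᵘ-injective (begin
  ℚ.toℚᵘ ((i ℤ.+ j) / 1)               ≈⟨ ℚ.toℚᵘ-fromℚᵘ (mkℚᵘ (i ℤ.+ j) 0) ⟩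
  mkℚᵘ (i ℤ.+ j) 0                     ≈⟨ *≡* (cong (ℤ._* pos 1) (sym (cong₂ ℤ._+_ (ℤ.*-identityʳ i) (ℤ.*-identityʳ j)))) ⟩
  mkℚᵘ i 0 ℚᵘ.+ mkℚᵘ j 0               ≈⟨ ℚᵘ.+-cong (ℚ.toℚᵘ-fromℚᵘ (mkℚᵘ i 0)) (ℚ.toℚᵘ-fromℚᵘ (mkℚᵘ j 0)) ⟨
  ℚ.toℚᵘ (i / 1) ℚᵘ.+ ℚ.toℚᵘ (j / 1)   ≈⟨ ℚ.toℚᵘ-homo-+ (i / 1) (j / 1) ⟨
  ℚ.toℚᵘ (i / 1 + j / 1)               ∎)
  where open ℚᵘ.≃-Reasoning

/1-homo-* : ∀ i j → (i ℤ.* j) / 1 ≡ i / 1 * (j / 1)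
/1-homo-* i j = ℚ.toℚᵘ-injective (begin
  ℚ.toℚᵘ ((i ℤ.* j) / 1)               ≈⟨ ℚ.toℚᵘ-fromℚᵘ (mkℚᵘ (i ℤ.* j) 0) ⟩
  mkℚᵘ i 0 ℚᵘ.* mkℚᵘ j 0               ≈⟨ ℚᵘ.*-cong (ℚ.toℚᵘ-fromℚᵘ (mkℚᵘ i 0)) (ℚ.toℚᵘ-fromℚᵘ (mkℚᵘ j 0)) ⟨
  ℚ.toℚᵘ (i / 1) ℚᵘ.* ℚ.toℚᵘ (j / 1)   ≈⟨ ℚ.toℚᵘ-homo-* (i / 1) (j / 1) ⟨
  ℚ.toℚᵘ (i / 1 * (j / 1))             ∎)
  where open ℚᵘ.≃-Reasoning

-- The cancellation behind the Möbius sum: a new block next to `suc m` others against the `suc m`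
-- ways of joining one of them. The shift excludes the count 0, where the sum would be 1.
signedFactorial-suc : ∀ m → signedFactorial (suc (suc m)) + (pos suc m) / 1 * signedFactorial (suc m) ≡ 0ℚ
signedFactorial-suc m = begin
  (s′ ℤ.* pos (suc m !)) / 1 + (pos suc m) / 1 * ((s ℤ.* pos (m !)) / 1)
    ≡⟨ cong (λ t → signedFactorial (suc (suc m)) + t) (/1-homo-* (pos suc m) (s ℤ.* pos (m !))) ⟨
  (s′ ℤ.* pos (suc m !)) / 1 + (pos suc m ℤ.* (s ℤ.* pos (m !))) / 1
    ≡⟨ /1-homo-+ (s′ ℤ.* pos (suc m !)) (pos suc m ℤ.* (s ℤ.* pos (m !))) ⟨
  (s′ ℤ.* pos (suc m !) ℤ.+ pos suc m ℤ.* (s ℤ.* pos (m !))) / 1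
    ≡⟨ cong (_/ 1) cancel ⟩
  0ℚ ∎
  where
  open ≡-Reasoning
  s = -1ℤ ℤ.^ m
  s′ = -1ℤ ℤ.^ suc m
  a = pos suc m ℤ.* (s ℤ.* pos (m !))
  cancel : s′ ℤ.* pos (suc m !) ℤ.+ pos suc m ℤ.* (s ℤ.* pos (m !)) ≡ pos 0
  cancel = begin
    s′ ℤ.* pos (suc m !) ℤ.+ a                  ≡⟨ cong (λ t → s′ ℤ.* t ℤ.+ a) (ℤ.pos-* (suc m) (m !)) ⟩
    -1ℤ ℤ.* s ℤ.* (pos suc m ℤ.* pos (m !)) ℤ.+ a ≡⟨ cong (ℤ._+ a) (ℤ.*-assoc -1ℤ s _) ⟩
    -1ℤ ℤ.* (s ℤ.* (pos suc m ℤ.* pos (m !))) ℤ.+ a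
      ≡⟨ cong (λ t → -1ℤ ℤ.* t ℤ.+ a) (trans (sym (ℤ.*-assoc s _ _))
           (trans (cong (ℤ._* pos (m !)) (ℤ.*-comm s (pos suc m))) (ℤ.*-assoc (pos suc m) s _))) ⟩
    -1ℤ ℤ.* a ℤ.+ a                           ≡⟨ cong (ℤ._+ a) (ℤ.-1*i≡-i a) ⟩
    ℤ.- a ℤ.+ a                               ≡⟨ ℤ.+-inverseˡ a ⟩
    pos 0                                       ∎

∑ℚ-𝟙 : ∀ {a p} {A : Set a} {P : A → Set p} (P? : U.Decidable P) (as : List A) →
        ∑ℚ as (λ a → 𝟙 (P? a)) ≡ (pos length (filter P? as)) / 1
∑ℚ-𝟙 P? []       = refl
∑ℚ-𝟙 P? (a ∷ as) with P? a
... | yes _ = trans (cong (λ t → 1ℚ + t) (∑ℚ-𝟙 P? as)) (sym (/1-homo-+ (pos 1) (pos length (filter P? as))))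
... | no  _ = trans (ℚ.+-identityˡ _) (∑ℚ-𝟙 P? as)

∑ℚ-insertions : ∀ (α : Family n) {f g} → (∀ {A β} → Insertion A α β → f β ≡ g A) →
                ∑ℚ (insertions α) f ≡ ∑ℚ α g
∑ℚ-insertions []      f≡g = refl
∑ℚ-insertions (A ∷ α) {f} f≡g = cong₂ _+_ (f≡g here)
  (trans (∑-map ℚ.+-0-monoid ((outside ∷ A) ∷_) (insertions α) f) (∑ℚ-insertions α (f≡g ∘ there)))

∑ℚ-∋ : ∀ {α : Family n} {j} → Disjoint α → Any (j ∈_) α → ∑ℚ α (λ A → 𝟙 (j ∈? A)) ≡ 1ℚ
∑ℚ-∋ {α = A ∷ α} {j} (d ∷ _) (here j∈A) = cong₂ _+_ (𝟙-true (j ∈? A) j∈A)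
  (∑ℚ-zero α λ {B} B∈ → 𝟙-false (j ∈? B) λ j∈B → All.lookup d B∈ (j , x∈p∩q⁺ (j∈A , j∈B)))
∑ℚ-∋ {α = A ∷ α} {j} (d ∷ ds) (there j∈) = cong₂ _+_
  (𝟙-false (j ∈? A) λ j∈A → let B , B∈ , j∈B = List.find j∈ in
     All.lookup d B∈ (j , x∈p∩q⁺ (j∈A , j∈B)))
  (∑ℚ-∋ ds j∈)

-- Sums over the partitions between two equivalence relations

module Extensions {S T : Rel (Fin (suc n)) 0ℓ} (S-equiv : IsEquivalence S) (T-equiv : IsEquivalence T)
  (S? : Decidable S) (T? : Decidable T) where

  private
    module S = IsEquivalence S-equiv
    module T = IsEquivalence T-equiv

  S′ T′ : Rel (Fin n) 0ℓ
  S′ i j = S (suc i) (suc j)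
  T′ i j = T (suc i) (suc j)

  S′? : Decidable S′
  S′? i j = S? (suc i) (suc j)

  T′? : Decidable T′
  T′? i j = T? (suc i) (suc j)

  Isolated : Set
  Isolated = ∀ j → ¬ S zero (suc j)

  isolated? : Dec Isolated
  isolated? = Fin.all? λ j → ¬? (S? zero (suc j))

  Fits : Subset n → Set
  Fits A = (∀ j → S zero (suc j) → j ∈ A) × (∀ j → j ∈ A → T zero (suc j))

  fits? : U.Decidable Fits
  fits? A = (Fin.all? λ j → S? zero (suc j) →-dec (j ∈? A)) ×-dec (Fin.all? λ j → (j ∈? A) →-dec T? zero (suc j))

  between-alone : ∀ {α} → Between S (alone α) T ⇔ (Between S′ α T′ × Isolated)
  between-alone {α} = mk⇔
    (λ (S⇛ , ⇛T) → ((λ i j s → to alone-suc (S⇛ _ _ s)) , λ i j t → ⇛T _ _ (from alone-suc t))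
                 , λ j s → alone-zero {α = α} (S⇛ _ _ s))
    (λ ((S⇛ , ⇛T) , isolated) →
      (λ { zero    zero    _ → here (here , here)
         ; zero    (suc j) s → contradiction s (isolated j)
         ; (suc i) zero    s → contradiction (S.sym s) (isolated i)
         ; (suc i) (suc j) s → from alone-suc (S⇛ i j s) })
    , (λ { zero    zero    _ → T.refl
         ; zero    (suc j) t → contradiction t (alone-zero {α = α})
         ; (suc i) zero    t → contradiction (Any.map swap t) (alone-zero {α = α})
         ; (suc i) (suc j) t → ⇛T i j (to alone-suc t) }))

  between-insertion : ∀ {A} {α : Family n} {β} → Insertion A α β →
                      Between S β T ⇔ (Between S′ α T′ × Fits A)
  between-insertion I = mk⇔
    (λ (S⇛ , ⇛T) → ((λ i j s → to (insertion-suc I) (S⇛ _ _ s)) , λ i j t → ⇛T _ _ (from (insertion-suc I) t))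
                 , (λ j s → to (insertion-zero I) (S⇛ _ _ s)) , λ j j∈A → ⇛T _ _ (from (insertion-zero I) j∈A))
    (λ ((S⇛ , ⇛T) , S⊆A , A⊆T) →
      (λ { zero    zero    _ → Any.map (λ z → z , z) (insertion-covers-zero I)
         ; zero    (suc j) s → from (insertion-zero I) (S⊆A j s)
         ; (suc i) zero    s → Any.map swap (from (insertion-zero I) (S⊆A i (S.sym s)))
         ; (suc i) (suc j) s → from (insertion-suc I) (S⇛ i j s) })
    , (λ { zero    zero    _ → T.refl
         ; zero    (suc j) t → A⊆T j (to (insertion-zero I) t)
         ; (suc i) zero    t → T.sym (A⊆T i (to (insertion-zero I) (Any.map swap t)))
         ; (suc i) (suc j) t → ⇛T i j (to (insertion-suc I) t) }))

  module _ {f : Family (suc n) → ℚ} {g h : Family n → ℚ}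
    (f-alone : ∀ {α} → α ∈ᴸ setPartitions n → f (alone α) ≡ g α)
    (f-insertion : ∀ {A α β} → α ∈ᴸ setPartitions n → Insertion A α β → Fits A → f β ≡ h α)
    where

    -- The weight of an extension depends only on `α` and on whether zero is alone, not on the block
    -- that zero joins. So the joins contribute through the number of fitting blocks only.
    ∑-between : ∑ℚ (setPartitions (suc n)) (λ β → 𝟙 (between? S? β T?) * f β) ≡
                ∑ℚ (setPartitions n) (λ α → 𝟙 (between? S′? α T′?) *
                  (𝟙 isolated? * g α + ∑ℚ α (λ A → 𝟙 (fits? A)) * h α))
    ∑-between = trans (∑-concatMap ℚ.+-0-monoid _ (setPartitions n) _) (∑ℚ-cong (setPartitions n) λ {α} α∈ → begin
      𝟙 (between? S? (alone α) T?) * f (alone α) + ∑ℚ (insertions α) (λ β → 𝟙 (between? S? β T?) * f β)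
        ≡⟨ cong₂ _+_
             (begin
               𝟙 (between? S? (alone α) T?) * f (alone α)
                 ≡⟨ cong₂ _*_
                      (trans (𝟙-cong between-alone (between? S? (alone α) T?) (between? S′? α T′? ×-dec isolated?))
                             (𝟙-× (between? S′? α T′?) isolated?))
                      (f-alone α∈) ⟩
               𝟙 (between? S′? α T′?) * 𝟙 isolated? * g α
                 ≡⟨ ℚ.*-assoc (𝟙 (between? S′? α T′?)) _ _ ⟩
               𝟙 (between? S′? α T′?) * (𝟙 isolated? * g α) ∎)
             (begin
               ∑ℚ (insertions α) (λ β → 𝟙 (between? S? β T?) * f β)
                 ≡⟨ ∑ℚ-insertions α {g = λ A → 𝟙 (between? S′? α T′?) * (𝟙 (fits? A) * h α)} (λ {A} {β} I → begin
                      𝟙 (between? S? β T?) * f β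
                        ≡⟨ cong (_* f β) (trans
                             (𝟙-cong (between-insertion I) (between? S? β T?) (between? S′? α T′? ×-dec fits? A))
                             (𝟙-× (between? S′? α T′?) (fits? A))) ⟩
                      𝟙 (between? S′? α T′?) * 𝟙 (fits? A) * f β
                        ≡⟨ ℚ.*-assoc (𝟙 (between? S′? α T′?)) _ _ ⟩
                      𝟙 (between? S′? α T′?) * (𝟙 (fits? A) * f β)
                        ≡⟨ cong (𝟙 (between? S′? α T′?) *_) (𝟙*-cong (fits? A) (f-insertion α∈ I)) ⟩
                      𝟙 (between? S′? α T′?) * (𝟙 (fits? A) * h α) ∎) ⟩
               ∑ℚ α (λ A → 𝟙 (between? S′? α T′?) * (𝟙 (fits? A) * h α))
                 ≡⟨ *-∑ℚ (𝟙 (between? S′? α T′?)) α _ ⟨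
               𝟙 (between? S′? α T′?) * ∑ℚ α (λ A → 𝟙 (fits? A) * h α)
                 ≡⟨ cong (𝟙 (between? S′? α T′?) *_) (∑ℚ-* α _ (h α)) ⟨
               𝟙 (between? S′? α T′?) * (∑ℚ α (λ A → 𝟙 (fits? A)) * h α) ∎) ⟩
      𝟙 (between? S′? α T′?) * (𝟙 isolated? * g α) + 𝟙 (between? S′? α T′?) * (∑ℚ α (λ A → 𝟙 (fits? A)) * h α)
        ≡⟨ ℚ.*-distribˡ-+ (𝟙 (between? S′? α T′?)) _ _ ⟨
      𝟙 (between? S′? α T′?) * (𝟙 isolated? * g α + ∑ℚ α (λ A → 𝟙 (fits? A)) * h α) ∎)
      where open ≡-Reasoning

  -- If zero is equivalent to j, it can only join the block of j.
  fits⇔ : ∀ {α A j} → Disjoint α → A ∈ᴸ α → S zero (suc j) → Between S′ α T′ →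
          Fits A ⇔ (j ∈ A × T zero (suc j))
  fits⇔ {j = j} d A∈ S0j (S⇛ , ⇛T) = mk⇔
    (λ (S⊆A , A⊆T) → S⊆A j S0j , A⊆T j (S⊆A j S0j))
    (λ (j∈A , T0j) →
        (λ i S0i → together⁻ d A∈ j∈A (S⇛ j i (S.trans (S.sym S0j) S0i)))
      , λ i i∈A → T.trans T0j (⇛T j i (together A∈ j∈A i∈A)))

  -- Exactly one block of `α` contains `j`, and no other block can receive zero; whether this one
  -- does is decided by `T` at `j`.
  ∑-fits : ∀ {α j} → IsWeakPartition α → S zero (suc j) → Between S′ α T′ →
           ∑ℚ α (λ A → 𝟙 (fits? A)) ≡ 𝟙 (T? zero (suc j))
  ∑-fits {α} {j} (weak d c) S0j between = begin
    ∑ℚ α (λ A → 𝟙 (fits? A))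
      ≡⟨ ∑ℚ-cong α (λ {A} A∈ → trans
           (𝟙-cong (fits⇔ d A∈ S0j between) (fits? A) ((j ∈? A) ×-dec T? zero (suc j)))
           (𝟙-× (j ∈? A) (T? zero (suc j)))) ⟩
    ∑ℚ α (λ A → 𝟙 (j ∈? A) * 𝟙 (T? zero (suc j)))
      ≡⟨ ∑ℚ-* α _ _ ⟨
    ∑ℚ α (λ A → 𝟙 (j ∈? A)) * 𝟙 (T? zero (suc j))
      ≡⟨ cong (_* 𝟙 (T? zero (suc j))) (∑ℚ-∋ d (c j)) ⟩
    1ℚ * 𝟙 (T? zero (suc j))
      ≡⟨ ℚ.*-identityˡ _ ⟩
    𝟙 (T? zero (suc j)) ∎
    where open ≡-Reasoning

setPartitions-weak : ∀ n {α} → α ∈ᴸ setPartitions n → IsWeakPartition α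
setPartitions-weak n α∈ = ⊢⇒weak (setPartitions-⊢ n α∈)

∈⇒length : ∀ {a} {A : Set a} {x : A} {xs} → x ∈ᴸ xs → ∃ λ m → length xs ≡ suc m
∈⇒length {xs = _ ∷ xs} _ = length xs , refl

-- This is the statement that `setPartitions` lists each partition exactly once. Zero has a single
-- choice at each step: the block of a partner if it has one, a block of its own otherwise.
∑-between-self : ∀ n {S : Rel (Fin n) 0ℓ} → IsEquivalence S → (S? : Decidable S) →
                 ∑ℚ (setPartitions n) (λ α → 𝟙 (between? S? α S?)) ≡ 1ℚ
∑-between-self zero    S-equiv S? = refl
∑-between-self (suc n) {S} S-equiv S? = begin
  ∑ℚ (setPartitions (suc n)) (λ β → 𝟙 (between? S? β S?))
    ≡⟨ ∑ℚ-cong (setPartitions (suc n)) (λ _ → sym (ℚ.*-identityʳ _)) ⟩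
  ∑ℚ (setPartitions (suc n)) (λ β → 𝟙 (between? S? β S?) * 1ℚ)
    ≡⟨ E.∑-between {g = λ _ → 1ℚ} {h = λ _ → 1ℚ} (λ _ → refl) (λ _ _ _ → refl) ⟩
  ∑ℚ (setPartitions n) (λ α → 𝟙 (between? E.S′? α E.T′?) *
    (𝟙 E.isolated? * 1ℚ + ∑ℚ α (λ A → 𝟙 (E.fits? A)) * 1ℚ))
    ≡⟨ ∑ℚ-cong (setPartitions n) (λ {α} α∈ → trans
         (𝟙*-cong (between? E.S′? α E.T′?) (extensions α∈)) (ℚ.*-identityʳ _)) ⟩
  ∑ℚ (setPartitions n) (λ α → 𝟙 (between? E.S′? α E.T′?))
    ≡⟨ ∑-between-self n (record { refl = S.refl ; sym = S.sym ; trans = S.trans }) E.S′? ⟩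
  1ℚ ∎
  where
  open ≡-Reasoning
  module S = IsEquivalence S-equiv
  module E = Extensions S-equiv S-equiv S? S?

  extensions : ∀ {α} → α ∈ᴸ setPartitions n → Between E.S′ α E.T′ →
               𝟙 E.isolated? * 1ℚ + ∑ℚ α (λ A → 𝟙 (E.fits? A)) * 1ℚ ≡ 1ℚ
  extensions {α} α∈ between with Fin.any? (λ j → S? zero (suc j))
  ... | yes (j , S0j) = cong₂ (λ p q → p * 1ℚ + q * 1ℚ)
    (𝟙-false E.isolated? λ isolated → isolated j S0j)
    (trans (E.∑-fits (setPartitions-weak n α∈) S0j between) (𝟙-true (S? zero (suc j)) S0j))
  ... | no ¬S0 = cong₂ (λ p q → p * 1ℚ + q * 1ℚ)
    (𝟙-true E.isolated? λ j S0j → ¬S0 (j , S0j))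
    -- Listed blocks are nonempty, so a block that fits would supply a partner of zero.
    (∑ℚ-zero α λ {A} A∈ → 𝟙-false (E.fits? A) λ (_ , A⊆S) →
      let i , i∈A = All.lookup (_⊢_.nonempty (setPartitions-⊢ n α∈)) A∈ in ¬S0 (i , A⊆S i i∈A))

-- The Möbius function

# : Family n → Subset n → ℕ
# α B = ℓ (filter (_⊆? B) α)

#-outside : ∀ (α : Family n) {b B} → # (map (outside ∷_) α) (b ∷ B) ≡ # α B
#-outside []      = refl
#-outside (A ∷ α) {b} {B} with A ⊆? B
... | yes _ = cong suc (#-outside α)
... | no  _ = #-outside α

#-alone-inside : ∀ (α : Family n) {B} → # (alone α) (inside ∷ B) ≡ suc (# α B)
#-alone-inside α {B} = trans
  (cong length (filter-accept (_⊆? (inside ∷ B)) {⁅ zero ⁆} {map (outside ∷_) α}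
    λ { here → here ; (there i∈) → contradiction i∈ ∉⊥ }))
  (cong suc (#-outside α))

#-alone-outside : ∀ (α : Family n) {B} → # (alone α) (outside ∷ B) ≡ # α B
#-alone-outside α {B} = trans
  (cong length (filter-reject (_⊆? (outside ∷ B)) {⁅ zero ⁆} {map (outside ∷_) α} λ ⊆ → contradiction (⊆ here) λ ()))
  (#-outside α)

#-insertion-inside : ∀ {A} {α : Family n} {β} → Insertion A α β → ∀ {B} → # β (inside ∷ B) ≡ # α B
#-insertion-inside {α = A ∷ α} here {B} with A ⊆? B
... | yes _ = cong suc (#-outside α)
... | no  _ = #-outside α
#-insertion-inside {α = C ∷ α} (there I) {B} with C ⊆? B
... | yes _ = cong suc (#-insertion-inside I)
... | no  _ = #-insertion-inside I

-- Once `A` contains zero it lies in no block without zero. The count survives because `A` was not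
-- counted before either.
#-insertion-outside : ∀ {A} {α : Family n} {β} → Insertion A α β → ∀ {B} → ¬ A ⊆ B → # β (outside ∷ B) ≡ # α B
#-insertion-outside {α = A ∷ α} here {B} A⊈B = trans (#-outside α)
  (sym (cong length (filter-reject (_⊆? B) {xs = α} A⊈B)))
#-insertion-outside {α = C ∷ α} (there I) {B} A⊈B with C ⊆? B
... | yes _ = cong suc (#-insertion-outside I A⊈B)
... | no  _ = #-insertion-outside I A⊈B

u-outside : ∀ (π α : Family n) β → (∀ {C} → C ∈ᴸ π → # β (outside ∷ C) ≡ # α C) →
             u β (map (outside ∷_) π) ≡ u α π
u-outside π α β eq = trans
  (∑-map ℚ.*-1-monoid (outside ∷_) π _)
  (∑-cong ℚ.*-1-monoid π λ C∈ → cong signedFactorial (eq C∈))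

-- The witness `q` is the product over the blocks of `π` other than `B`. Exposing it as a common
-- factor compares the two values without division.
u-alone : ∀ {B} {π : Family n} {ρ} → Insertion B π ρ → ∀ α → ∃ λ q →
          u (alone α) ρ ≡ signedFactorial (suc (# α B)) * q × u α π ≡ signedFactorial (# α B) * q
u-alone {π = B ∷ π} here α = u α π
  , cong₂ (λ c q → signedFactorial c * q) (#-alone-inside α) (u-outside π α (alone α) λ _ → #-alone-outside α)
  , refl
u-alone {B = B} {π = C ∷ π} (there {β = ρ} I) α with q , alone-eq , eq ← u-alone I α =
    signedFactorial (# α C) * q
  , trans (cong₂ (λ c q → signedFactorial c * q) (#-alone-outside α) alone-eq)
          (*ℚ.x∙yz≈y∙xz (signedFactorial (# α C)) (signedFactorial (suc (# α B))) q)
  , trans (cong (signedFactorial (# α C) *_) eq) (*ℚ.x∙yz≈y∙xz (signedFactorial (# α C)) (signedFactorial (# α B)) q)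

-- Being nonempty, `A` lies in no block of the disjoint family `π` except `B`, so the other counts
-- do not notice that it grows; in `B` it is still counted, because `B` grows with it.
u-insertion : ∀ {A} {α : Family n} {β} → Insertion A α β → Nonempty A →
              ∀ {B} {π : Family n} {ρ} → Insertion B π ρ → Disjoint π → A ⊆ B → u β ρ ≡ u α π
u-insertion {α = α} {β} I (i , i∈A) {π = B ∷ π} here (d ∷ _) A⊆B = cong₂ (λ c q → signedFactorial c * q)
  (#-insertion-inside I)
  (u-outside π α β λ C∈ → #-insertion-outside I λ A⊆C → All.lookup d C∈ (i , x∈p∩q⁺ (A⊆B i∈A , A⊆C i∈A)))
u-insertion I (i , i∈A) {π = C ∷ π} (there J) (d ∷ ds) A⊆B = cong₂ (λ c q → signedFactorial c * q)
  (#-insertion-outside I λ A⊆C → All.lookup d (insertion-∈ J) (i , x∈p∩q⁺ (A⊆C i∈A , A⊆B i∈A)))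
  (u-insertion I (i , i∈A) J ds A⊆B)

strip-outside : ∀ {B} (π : Family (suc n)) → All (λ C → Empty ((inside ∷ B) ∩ C)) π →
                ∃ λ ρ → π ≡ map (outside ∷_) ρ
strip-outside []                  []       = [] , refl
strip-outside ((outside ∷ C) ∷ π) (_ ∷ ds) with ρ , refl ← strip-outside π ds = C ∷ ρ , refl
strip-outside ((inside ∷ C) ∷ π)  (d ∷ _)  = contradiction (zero , here) d

insertion⁻ : ∀ (π : Family (suc n)) → Disjoint π → Any (zero ∈_) π → ∃₂ λ B ρ → Insertion B ρ π
insertion⁻ ((inside ∷ B) ∷ π)  (d ∷ _)  _          with ρ , refl ← strip-outside π d = B , B ∷ ρ , here
insertion⁻ ((outside ∷ C) ∷ π) (_ ∷ ds) (there 0∈) with B , ρ , I ← insertion⁻ π ds 0∈ = B , C ∷ ρ , there I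

outside-disjoint⁻ : ∀ {b B} {π : Family n} → All (λ C → Empty ((b ∷ B) ∩ C)) (map (outside ∷_) π) →
                    All (λ C → Empty (B ∩ C)) π
outside-disjoint⁻ = All.map (λ d (i , i∈) → d (suc i , there i∈)) ∘ All.map⁻

insertion-disjoint⁻ : ∀ {A} {π : Family n} {ρ} → Insertion A π ρ → Disjoint ρ → Disjoint π
insertion-disjoint⁻ here      (d ∷ ds) = outside-disjoint⁻ d ∷
  AllPairs.map (λ d (i , i∈) → d (suc i , there i∈)) (AllPairs.map⁻ ds)
insertion-disjoint⁻ (there I) (d ∷ ds) = go I d ∷ insertion-disjoint⁻ I ds
  where
  go : ∀ {A B} {π : Family n} {ρ} → Insertion A π ρ →
       All (λ C → Empty ((outside ∷ B) ∩ C)) ρ → All (λ C → Empty (B ∩ C)) π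
  go here      (d ∷ ds) = (λ (i , i∈) → d (suc i , there i∈)) ∷ outside-disjoint⁻ ds
  go (there I) (d ∷ ds) = (λ (i , i∈) → d (suc i , there i∈)) ∷ go I ds

insertion-weak⁻ : ∀ {A} {π : Family n} {ρ} → Insertion A π ρ → IsWeakPartition ρ → IsWeakPartition π
insertion-weak⁻ I w@(weak d c) = weak (insertion-disjoint⁻ I d) λ i →
  Any.map proj₁ (to (insertion-suc I) (IsEquivalence.refl (together-equivalence w) {suc i}))

-- Deleting zero from `ρ` may leave an empty block, hence the weak hypothesis. Over each `α` the
-- extensions contribute `K * u α π` with the same `K` throughout, so the sum reduces to the one for
-- `π`; `K` then decides whether `B` is the right block for zero with respect to `S`.
∑-between-u : ∀ n {S : Rel (Fin n) 0ℓ} → IsEquivalence S → (S? : Decidable S) →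
              ∀ {π : Family n} → IsWeakPartition π →
              ∑ℚ (setPartitions n) (λ α → 𝟙 (between? S? α (together? π)) * u α π) ≡ 𝟙 (between? S? π S?)
∑-between-u zero    S-equiv S? {π} w = trans (ℚ.+-identityʳ _) (trans (ℚ.*-identityˡ _) (u-empty π))
  where
  u-empty : ∀ (π : Family 0) → u [] π ≡ 1ℚ
  u-empty []      = refl
  u-empty (B ∷ π) = trans (ℚ.*-identityˡ _) (u-empty π)
∑-between-u (suc n) {S} S-equiv S? {ρ} w@(weak ds c) with B , π , I ← insertion⁻ ρ ds (c zero) = begin
  ∑ℚ (setPartitions (suc n)) (λ β → 𝟙 (between? S? β (together? ρ)) * u β ρ)
    ≡⟨ E.∑-between {g = λ α → u (alone α) ρ} {h = λ α → u α π} (λ _ → refl)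
         (λ {A} α∈ J (_ , A⊆) → u-insertion J
           (All.lookup (_⊢_.nonempty (setPartitions-⊢ n α∈)) (insertion-∈ J)) I (IsWeakPartition.disjoint w′)
           λ {i} i∈A → to (insertion-zero I) (A⊆ i i∈A)) ⟩
  ∑ℚ (setPartitions n) (λ α → 𝟙 (between? E.S′? α E.T′?) *
    (𝟙 E.isolated? * u (alone α) ρ + ∑ℚ α (λ A → 𝟙 (E.fits? A)) * u α π))
    ≡⟨ ∑ℚ-cong (setPartitions n) (λ {α} α∈ → trans
         (𝟙*-cong (between? E.S′? α E.T′?) (proj₁ (proj₂ factor) α∈))
         (trans (*ℚ.x∙yz≈y∙xz (𝟙 (between? E.S′? α E.T′?)) K (u α π))
           (cong (λ t → K * (t * u α π)) (𝟙-cong between⇔ (between? E.S′? α E.T′?) (between? E.S′? α (together? π)))))) ⟩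
  ∑ℚ (setPartitions n) (λ α → K * (𝟙 (between? E.S′? α (together? π)) * u α π))
    ≡⟨ *-∑ℚ K (setPartitions n) _ ⟨
  K * ∑ℚ (setPartitions n) (λ α → 𝟙 (between? E.S′? α (together? π)) * u α π)
    ≡⟨ cong (K *_) (∑-between-u n (record { refl = S.refl ; sym = S.sym ; trans = S.trans }) E.S′? w′) ⟩
  K * 𝟙 (between? E.S′? π E.S′?)
    ≡⟨ ℚ.*-comm K _ ⟩
  𝟙 (between? E.S′? π E.S′?) * K
    -- `K` is identified only where the indicator is nonzero, that is, when `π` agrees with `S` away
    -- from zero.
    ≡⟨ 𝟙*-cong (between? E.S′? π E.S′?) (proj₂ (proj₂ factor)) ⟩
  𝟙 (between? E.S′? π E.S′?) * 𝟙 (D.fits? B)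
    ≡⟨ 𝟙-× (between? E.S′? π E.S′?) (D.fits? B) ⟨
  𝟙 (between? E.S′? π E.S′? ×-dec D.fits? B)
    ≡⟨ 𝟙-cong (D.between-insertion I) (between? S? ρ S?) (between? E.S′? π E.S′? ×-dec D.fits? B) ⟨
  𝟙 (between? S? ρ S?) ∎
  where
  open ≡-Reasoning
  T-equiv = together-equivalence w
  module S = IsEquivalence S-equiv
  module T = IsEquivalence T-equiv
  module E = Extensions S-equiv T-equiv S? (together? ρ)
  module D = Extensions S-equiv S-equiv S? S?
  w′ = insertion-weak⁻ I w

  between⇔ : ∀ {α} → Between E.S′ α E.T′ ⇔ Between E.S′ α (Together π)
  between⇔ = mk⇔ (map₂ λ ⇛T i j t → to (insertion-suc I) (⇛T i j t))
                 (map₂ λ ⇛T i j t → from (insertion-suc I) (⇛T i j t))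

  ∑-fits-isolated : ¬ (∃ λ j → S zero (suc j)) → ∀ α → ∑ℚ α (λ A → 𝟙 (E.fits? A)) ≡ (pos # α B) / 1
  ∑-fits-isolated ¬S0 α = trans
    (∑ℚ-cong α λ {A} _ → 𝟙-cong (mk⇔
      (λ (_ , A⊆T) {i} i∈A → to (insertion-zero I) (A⊆T i i∈A))
      (λ A⊆B → (λ j S0j → contradiction (j , S0j) ¬S0) , λ i i∈A → from (insertion-zero I) (A⊆B i∈A)))
      (E.fits? A) (A ⊆? B))
    (∑ℚ-𝟙 (_⊆? B) α)

  -- The cases depend on whether zero has a partner in `S` and in `ρ`, never on `α`. This keeps `K`
  -- constant over the sum although the number of fitting blocks may vary with `α`.
  factor : ∃ λ K → (∀ {α} → α ∈ᴸ setPartitions n → Between E.S′ α E.T′ →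
                    𝟙 E.isolated? * u (alone α) ρ + ∑ℚ α (λ A → 𝟙 (E.fits? A)) * u α π ≡ K * u α π)
                 × (Between E.S′ π E.S′ → K ≡ 𝟙 (D.fits? B))
  factor with Fin.any? (λ j → S? zero (suc j)) | Fin.any? (λ j → together? ρ zero (suc j))
  -- Zero must join the block of `j`. The term with zero alone vanishes, and the one remaining join
  -- is allowed precisely when `ρ` also puts `j` with zero.
  ... | yes (j , S0j) | _ = 𝟙 (together? ρ zero (suc j))
    , (λ {α} α∈ between → begin
        𝟙 E.isolated? * u (alone α) ρ + ∑ℚ α (λ A → 𝟙 (E.fits? A)) * u α π
          ≡⟨ cong₂ (λ p q → p * u (alone α) ρ + q * u α π)
               (𝟙-false E.isolated? λ isolated → isolated j S0j)
               (E.∑-fits (setPartitions-weak n α∈) S0j between) ⟩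
        0ℚ * u (alone α) ρ + 𝟙 (together? ρ zero (suc j)) * u α π
          ≡⟨ cong (_+ 𝟙 (together? ρ zero (suc j)) * u α π) (ℚ.*-zeroˡ (u (alone α) ρ)) ⟩
        0ℚ + 𝟙 (together? ρ zero (suc j)) * u α π
          ≡⟨ ℚ.+-identityˡ _ ⟩
        𝟙 (together? ρ zero (suc j)) * u α π ∎)
    , λ between → let fits = D.fits⇔ (IsWeakPartition.disjoint w′) (insertion-∈ I) S0j between in
        𝟙-cong (mk⇔ (λ t → from fits (to (insertion-zero I) t , S0j)) (λ f → from (insertion-zero I) (proj₁ (to fits f))))
               (together? ρ zero (suc j)) (D.fits? B)
  ... | no ¬S0 | yes (j , T0j) = 0ℚ
    , (λ {α} α∈ (_ , ⇛T) →
        let A , A∈α , j∈A = block (setPartitions-weak n α∈) j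
            A⊆B = λ {i} i∈A → to (insertion-zero I) (T.trans T0j (⇛T j i (together A∈α j∈A i∈A)))
            -- The cancellation needs at least one block of `α` inside `B`. The block of `j` is one,
            -- since `j` shares a block of `ρ` with zero and `α` stays below `ρ`.
            m , #≡ = ∈⇒length (∈-filter⁺ (_⊆? B) A∈α A⊆B)
            q , alone-eq , eq = u-alone I α
        in begin
        𝟙 E.isolated? * u (alone α) ρ + ∑ℚ α (λ A → 𝟙 (E.fits? A)) * u α π
          ≡⟨ cong₂ _+_
               (trans (cong (_* u (alone α) ρ) (𝟙-true E.isolated? (λ j S0j → ¬S0 (j , S0j))))
                      (ℚ.*-identityˡ (u (alone α) ρ)))
               (cong₂ _*_ (∑-fits-isolated ¬S0 α) eq) ⟩
        u (alone α) ρ + (pos # α B) / 1 * (signedFactorial (# α B) * q)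
          ≡⟨ cong₂ _+_ alone-eq (sym (ℚ.*-assoc ((pos # α B) / 1) _ q)) ⟩
        signedFactorial (suc (# α B)) * q + (pos # α B) / 1 * signedFactorial (# α B) * q
          ≡⟨ ℚ.*-distribʳ-+ q (signedFactorial (suc (# α B))) ((pos # α B) / 1 * signedFactorial (# α B)) ⟨
        (signedFactorial (suc (# α B)) + (pos # α B) / 1 * signedFactorial (# α B)) * q
          ≡⟨ cong (λ c → (signedFactorial (suc c) + (pos c) / 1 * signedFactorial c) * q) #≡ ⟩
        (signedFactorial (suc (suc m)) + (pos suc m) / 1 * signedFactorial (suc m)) * q
          ≡⟨ cong (_* q) (signedFactorial-suc m) ⟩
        0ℚ * q
          ≡⟨ trans (ℚ.*-zeroˡ q) (sym (ℚ.*-zeroˡ (u α π))) ⟩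
        0ℚ * u α π ∎)
    , λ _ → sym (𝟙-false (D.fits? B) λ (_ , B⊆) → ¬S0 (j , B⊆ j (to (insertion-zero I) T0j)))
  -- Here `B` is empty and contains no block of `α`, so only the term with zero alone survives. It
  -- equals `u α π` because `signedFactorial` takes the value 1 both at 1 and, by truncated
  -- subtraction, at 0.
  ... | no ¬S0 | no ¬T0 = 1ℚ
    , (λ {α} α∈ _ →
        let #≡0 = cong length (filter-none (_⊆? B) (All.map
              (λ (i , i∈A) A⊆B → ¬T0 (i , from (insertion-zero I) (A⊆B i∈A)))
              (_⊢_.nonempty (setPartitions-⊢ n α∈))))
            q , alone-eq , eq = u-alone I α
        in begin
        𝟙 E.isolated? * u (alone α) ρ + ∑ℚ α (λ A → 𝟙 (E.fits? A)) * u α π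
          ≡⟨ cong₂ (λ c d → c * u (alone α) ρ + d * u α π)
               (𝟙-true E.isolated? (λ j S0j → ¬S0 (j , S0j)))
               (trans (∑-fits-isolated ¬S0 α) (cong (λ c → (pos c) / 1) #≡0)) ⟩
        1ℚ * u (alone α) ρ + 0ℚ * u α π
          ≡⟨ trans (cong₂ _+_ (ℚ.*-identityˡ (u (alone α) ρ)) (ℚ.*-zeroˡ (u α π))) (ℚ.+-identityʳ _) ⟩
        u (alone α) ρ
          ≡⟨ trans alone-eq (cong (λ c → signedFactorial (suc c) * q) #≡0) ⟩
        1ℚ * q
          ≡⟨ trans eq (cong (λ c → signedFactorial c * q) #≡0) ⟨
        u α π
          ≡⟨ ℚ.*-identityˡ _ ⟨
        1ℚ * u α π ∎)
    , λ _ → sym (𝟙-true (D.fits? B) ((λ j S0j → contradiction (j , S0j) ¬S0)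
                                   , λ j j∈B → contradiction (j , from (insertion-zero I) j∈B) ¬T0))

  K = proj₁ factor

-- Refinement as inclusion of equivalence relations

-- From relations back to blocks, any element of a nonempty block of `σ` selects the block of `π`,
-- and disjointness of `π` forces all its partners into that same block.
≤⇔⇛ : ∀ {σ π : Family n} → All Nonempty σ → Disjoint π → σ ≤ π ⇔ (Together σ ⇛ Together π)
≤⇔⇛ {σ = σ} {π} ne d = mk⇔
  (λ { (refines r) i j i~j →
       let A , A∈σ , i∈A , j∈A = List.find i~j
           B , B∈π , A⊆B = List.find (All.lookup r A∈σ)
       in together B∈π (A⊆B i∈A) (A⊆B j∈A) })
  (λ (⇛ : Together σ ⇛ Together π) → refines (All.tabulate λ {A} A∈σ →
    let i , i∈A = All.lookup ne A∈σ
        B , B∈π , i∈B , _ = List.find (⇛ i i (together A∈σ i∈A i∈A))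
    in List.lose B∈π λ {j} j∈A → together⁻ d B∈π i∈B (⇛ i j (together A∈σ i∈A j∈A))))

≤-antisym : ∀ {σ π : Family n} → All Nonempty σ → Disjoint σ → σ ≤ π → π ≤ σ →
            ∀ {A} → A ∈ᴸ σ → A ∈ᴸ π
≤-antisym ne d (refines σ≤π) (refines π≤σ) {A} A∈σ =
  let i , i∈A = All.lookup ne A∈σ
      B , B∈π , A⊆B = List.find (All.lookup σ≤π A∈σ)
      C , C∈σ , B⊆C = List.find (All.lookup π≤σ B∈π)
      A≡C = disjoint⇒≡ d A∈σ C∈σ i∈A (B⊆C (A⊆B i∈A))
  in subst (_∈ᴸ _) (⊆-antisym (λ {j} j∈B → subst (j ∈_) (sym A≡C) (B⊆C j∈B)) A⊆B) B∈π

≋⇔between : ∀ {α σ : Family n} → α ⊢ ⊤ → σ ⊢ ⊤ → α ≋ σ ⇔ Between (Together σ) α (Together σ)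
≋⇔between {α = α} {σ} α⊢ σ⊢ = mk⇔
  (λ { (same α⊆σ σ⊆α) → (λ _ _ → transport σ⊆α) , λ _ _ → transport α⊆σ })
  (λ (σ⇛α , α⇛σ) →
    let α≤σ = from (≤⇔⇛ (_⊢_.nonempty α⊢) (_⊢_.disjoint σ⊢)) α⇛σ
        σ≤α = from (≤⇔⇛ (_⊢_.nonempty σ⊢) (_⊢_.disjoint α⊢)) σ⇛α
    in same (≤-antisym (_⊢_.nonempty α⊢) (_⊢_.disjoint α⊢) α≤σ σ≤α)
            (≤-antisym (_⊢_.nonempty σ⊢) (_⊢_.disjoint σ⊢) σ≤α α≤σ))
  where
  transport : ∀ {π ρ : Family _} → (∀ {A} → A ∈ᴸ π → A ∈ᴸ ρ) → ∀ {i j} → Together π i j → Together ρ i j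
  transport π⊆ρ i~j = let A , A∈ , ∈A = List.find i~j in List.lose (π⊆ρ A∈) ∈A

-- Words with a prescribed kernel

colour : Family n → Fin n → ℕ
colour []      i = 0
colour (A ∷ π) i with i ∈? A
... | yes _ = 0
... | no  _ = suc (colour π i)

colour-together : ∀ {π : Family n} {i j} → Disjoint π → Together π i j → colour π i ≡ colour π j
colour-together {π = A ∷ π} {i} {j} (d ∷ ds) i~j with i ∈? A | j ∈? A
... | yes _   | yes _   = refl
... | no  _   | no  j∉A with i~j
...   | here (_ , j∈A) = contradiction j∈A j∉A
...   | there i~j′     = cong suc (colour-together ds i~j′)
colour-together (d ∷ ds) i~j | yes i∈A | no  j∉A =
  contradiction (together⁻ (d ∷ ds) (here refl) i∈A i~j) j∉A
colour-together (d ∷ ds) i~j | no  i∉A | yes j∈A =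
  contradiction (together⁻ (d ∷ ds) (here refl) j∈A (Any.map swap i~j)) i∉A

-- A colour is the position of the first block containing the point. Points in no block all get the
-- number of blocks, so equal colours are informative only for covered points.
colour-together⁻ : ∀ {π : Family n} {i j} → Any (i ∈_) π → Any (j ∈_) π →
                   colour π i ≡ colour π j → Together π i j
colour-together⁻ {π = A ∷ π} {i} {j} i∈ j∈ eq with i ∈? A | j ∈? A | i∈ | j∈
... | yes i∈A | yes j∈A | _         | _         = here (i∈A , j∈A)
... | no i∉A  | _       | here i∈A  | _         = contradiction i∈A i∉A
... | no _    | no j∉A  | _         | here j∈A  = contradiction j∈A j∉A
... | no _    | no _    | there i∈′ | there j∈′ = there (colour-together⁻ i∈′ j∈′ (ℕ.suc-injective eq))
colour-together⁻ i∈ j∈ () | yes _ | no _  | _ | _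
colour-together⁻ i∈ j∈ () | no _  | yes _ | _ | _

word : Family n → List ℕ
word ρ = tabulate (colour ρ)

tabulate-injective : ∀ {a} {A : Set a} {f g : Fin n → A} → tabulate f ≡ tabulate g → ∀ i → f i ≡ g i
tabulate-injective eq zero    = proj₁ (∷-injective eq)
tabulate-injective eq (suc i) = tabulate-injective (proj₂ (∷-injective eq)) i

occursIn-word : ∀ {β ρ : Family n} → IsWeakPartition ρ → OccursIn (word ρ) β ⇔ (Together β ⇛ Together ρ)
occursIn-word {ρ = ρ} (weak d c) = mk⇔
  (λ (f , w≡ , constant) i j i~j →
    let A , A∈β , i∈A , j∈A = List.find i~j
        colour≡ = tabulate-injective w≡
    in colour-together⁻ (c i) (c j)
         (trans (colour≡ i) (trans (All.lookup constant A∈β i j i∈A j∈A) (sym (colour≡ j)))))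
  (λ ⇛ → colour ρ , refl , All.tabulate λ A∈β i j i∈A j∈A →
    colour-together d (⇛ i j (together A∈β i∈A j∈A)))

occursIn-word-size : ∀ {β : Family m} {ρ : Family n} → OccursIn (word ρ) β → m ≡ n
occursIn-word-size {ρ = ρ} (f , w≡ , _) =
  trans (sym (length-tabulate f)) (trans (cong length (sym w≡)) (length-tabulate (colour ρ)))

-- Linear functionals

open NCSym
private
  module NC = LeftModule ncsym
  module NC⊗NC = LeftModule ncsym⊗ncsym

open NC using (_+ᴹ_; _*ₗ_; 0ᴹ; +ᴹ-rawMonoid)

record Functional : Set where
  field
    ⟨_⟩     : NCSym → ℚ
    ⟨⟩-cong : ∀ {f g} → f ≈ g → ⟨ f ⟩ ≡ ⟨ g ⟩
    ⟨⟩-+    : ∀ f g → ⟨ f +ᴹ g ⟩ ≡ ⟨ f ⟩ + ⟨ g ⟩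
    ⟨⟩-*    : ∀ q f → ⟨ q *ₗ f ⟩ ≡ q * ⟨ f ⟩

  ⟨⟩-∑ : ∀ {a} {A : Set a} (as : List A) (f : A → NCSym) →
         ⟨ ∑ +ᴹ-rawMonoid as f ⟩ ≡ ∑ℚ as (λ a → ⟨ f a ⟩)
  ⟨⟩-∑ []       f = trans (⟨⟩-cong (mk≈ λ _ → sym (ℚ.*-zeroˡ 0ℚ))) (trans (⟨⟩-* 0ℚ 0ᴹ) (ℚ.*-zeroˡ ⟨ 0ᴹ ⟩))
  ⟨⟩-∑ (a ∷ as) f = trans (⟨⟩-+ (f a) _) (cong (⟨ f a ⟩ +_) (⟨⟩-∑ as f))

open Functional

coeffᶠ : List ℕ → Functional
coeffᶠ w = record
  { ⟨_⟩     = λ f → coeff f w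
  ; ⟨⟩-cong = λ f≈g → _≈_.coeff-≡ f≈g w
  ; ⟨⟩-+    = λ _ _ → refl
  ; ⟨⟩-*    = λ _ _ → refl
  }

combinationᶠ : ∀ {a} {A : Set a} → List A → (A → ℚ) → (A → Functional) → Functional
combinationᶠ as c F = record
  { ⟨_⟩     = λ f → ∑ℚ as λ a → c a * ⟨ F a ⟩ f
  ; ⟨⟩-cong = λ f≈g → ∑ℚ-cong as λ {a} _ → cong (c a *_) (⟨⟩-cong (F a) f≈g)
  ; ⟨⟩-+    = λ f g → trans
      (∑ℚ-cong as λ {a} _ → trans (cong (c a *_) (⟨⟩-+ (F a) f g)) (ℚ.*-distribˡ-+ (c a) _ _))
      (∑ℚ-+ as _ _)
  ; ⟨⟩-*    = λ q f → trans
      (∑ℚ-cong as λ {a} _ → trans (cong (c a *_) (⟨⟩-* (F a) q f)) (*ℚ.x∙yz≈y∙xz (c a) q _))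
      (sym (*-∑ℚ q as _))
  }

-- In p β the word of ρ has coefficient [β ≤ ρ], which Möbius inversion turns into [β = π].
p-coefficient : Family n → Functional
p-coefficient {n} π = combinationᶠ (setPartitions n)
  (λ ρ → 𝟙 (⇛? (together? ρ) (together? π)) * u ρ π) (λ ρ → coeffᶠ (word ρ))

-- The expansion p π = ∑ x σ over σ ≤ π suggests summing the p-coefficients over all π ≥ σ.
x-coefficient : Family n → Functional
x-coefficient {n} σ = combinationᶠ (setPartitions n)
  (λ π → 𝟙 (⇛? (together? σ) (together? π))) p-coefficient

p-coefficient-p : ∀ {β π : Family n} → IsWeakPartition β → IsWeakPartition π →
                  ⟨ p-coefficient π ⟩ (p β) ≡ 𝟙 (between? (together? β) π (together? β))
p-coefficient-p {n} {β} {π} β-weak π-weak = begin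
  ∑ℚ (setPartitions n) (λ ρ → 𝟙 (ρ⇛π? ρ) * u ρ π * 𝟙 (occursIn? (word ρ) β))
    ≡⟨ ∑ℚ-cong (setPartitions n) (λ {ρ} ρ∈ → begin
         𝟙 (ρ⇛π? ρ) * u ρ π * 𝟙 (occursIn? (word ρ) β)
           ≡⟨ cong (𝟙 (ρ⇛π? ρ) * u ρ π *_)
                (𝟙-cong (occursIn-word (setPartitions-weak n ρ∈)) (occursIn? (word ρ) β) (β⇛ρ? ρ)) ⟩
         𝟙 (ρ⇛π? ρ) * u ρ π * 𝟙 (β⇛ρ? ρ)
           ≡⟨ ℚ.*-comm _ (𝟙 (β⇛ρ? ρ)) ⟩
         𝟙 (β⇛ρ? ρ) * (𝟙 (ρ⇛π? ρ) * u ρ π)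
           ≡⟨ ℚ.*-assoc (𝟙 (β⇛ρ? ρ)) _ _ ⟨
         𝟙 (β⇛ρ? ρ) * 𝟙 (ρ⇛π? ρ) * u ρ π
           ≡⟨ cong (_* u ρ π) (𝟙-× (β⇛ρ? ρ) (ρ⇛π? ρ)) ⟨
         𝟙 (between? (together? β) ρ (together? π)) * u ρ π ∎) ⟩
  ∑ℚ (setPartitions n) (λ ρ → 𝟙 (between? (together? β) ρ (together? π)) * u ρ π)
    ≡⟨ ∑-between-u n (together-equivalence β-weak) (together? β) π-weak ⟩
  𝟙 (between? (together? β) π (together? β)) ∎
  where
  open ≡-Reasoning
  ρ⇛π? = λ ρ → ⇛? (together? ρ) (together? π)
  β⇛ρ? = λ ρ → ⇛? (together? β) (together? ρ)

≤-size : {σ : Family m} {π : Family n} → σ ≤ π → m ≡ n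
≤-size (refines _) = refl

≋-size : {σ : Family m} {π : Family n} → σ ≋ π → m ≡ n
≋-size (same _ _) = refl

x-coefficient-p : ∀ {σ : Family m} {β : Family n} → σ ⊢ ⊤ → β ⊢ ⊤ → ⟨ x-coefficient σ ⟩ (p β) ≡ 𝟙 (σ ≤? β)
x-coefficient-p {m} {n} {σ} {β} σ⊢ β⊢ with n ℕ.≟ m
-- The words being read have length `m` and those occurring in `p β` have length `n`, so both sides
-- vanish.
... | no n≢m = trans
  (∑ℚ-zero (setPartitions m) λ {π} _ → trans
    (cong (𝟙 (⇛? (together? σ) (together? π)) *_) (∑ℚ-zero (setPartitions m) λ {ρ} _ → trans
      (cong (𝟙 (⇛? (together? ρ) (together? π)) * u ρ π *_)
        (𝟙-false (occursIn? (word ρ) β) λ o → n≢m (occursIn-word-size {ρ = ρ} o)))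
      (ℚ.*-zeroʳ (𝟙 (⇛? (together? ρ) (together? π)) * u ρ π))))
    (ℚ.*-zeroʳ (𝟙 (⇛? (together? σ) (together? π)))))
  (sym (𝟙-false (σ ≤? β) λ σ≤β → n≢m (sym (≤-size σ≤β))))
... | yes refl = begin
  ∑ℚ (setPartitions n) (λ π → 𝟙 (σ⇛π? π) * ⟨ p-coefficient π ⟩ (p β))
    ≡⟨ ∑ℚ-cong (setPartitions n) (λ {π} π∈ → begin
         𝟙 (σ⇛π? π) * ⟨ p-coefficient π ⟩ (p β)
           ≡⟨ cong (𝟙 (σ⇛π? π) *_) (p-coefficient-p (⊢⇒weak β⊢) (setPartitions-weak n π∈)) ⟩
         𝟙 (σ⇛π? π) * 𝟙 (β≈π? π)
           ≡⟨ ℚ.*-comm (𝟙 (σ⇛π? π)) _ ⟩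
         𝟙 (β≈π? π) * 𝟙 (σ⇛π? π)
           ≡⟨ 𝟙*-cong (β≈π? π) (λ (β⇛π , π⇛β) → 𝟙-cong
                (mk⇔ (λ σ⇛π i j → π⇛β i j ∘ σ⇛π i j) (λ σ⇛β i j → β⇛π i j ∘ σ⇛β i j))
                (σ⇛π? π) (σ⇛π? β)) ⟩
         𝟙 (β≈π? π) * 𝟙 (σ⇛π? β) ∎) ⟩
  ∑ℚ (setPartitions n) (λ π → 𝟙 (β≈π? π) * 𝟙 (σ⇛π? β))
    ≡⟨ ∑ℚ-* (setPartitions n) _ _ ⟨
  ∑ℚ (setPartitions n) (λ π → 𝟙 (β≈π? π)) * 𝟙 (σ⇛π? β)
    -- Only the terms with `π` equal to `β` are left, and `β` is listed once.
    ≡⟨ cong (_* 𝟙 (σ⇛π? β)) (∑-between-self n (together-equivalence (⊢⇒weak β⊢)) (together? β)) ⟩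
  1ℚ * 𝟙 (σ⇛π? β)
    ≡⟨ ℚ.*-identityˡ _ ⟩
  𝟙 (σ⇛π? β)
    ≡⟨ 𝟙-cong (≤⇔⇛ (_⊢_.nonempty σ⊢) (_⊢_.disjoint β⊢)) (σ ≤? β) (σ⇛π? β) ⟨
  𝟙 (σ ≤? β) ∎
  where
  open ≡-Reasoning
  σ⇛π? = λ π → ⇛? (together? σ) (together? π)
  β≈π? = λ π → between? (together? β) π (together? β)

x-coefficient-x : ∀ {σ : Family m} {α : Family n} → σ ⊢ ⊤ → α ⊢ ⊤ → ⟨ x-coefficient σ ⟩ (x α) ≡ 𝟙 (α ≋? σ)
x-coefficient-x {m} {n} {σ} {α} σ⊢ α⊢ = begin
  ⟨ φ ⟩ (x α)
    ≡⟨ ⟨⟩-∑ φ (filter (_≤? α) (setPartitions n)) _ ⟩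
  ∑ℚ (filter (_≤? α) (setPartitions n)) (λ β → ⟨ φ ⟩ (u β α *ₗ p β))
    ≡⟨ ∑ℚ-filter (_≤? α) (setPartitions n) _ ⟩
  ∑ℚ (setPartitions n) (λ β → 𝟙 (β ≤? α) * ⟨ φ ⟩ (u β α *ₗ p β))
    ≡⟨ ∑ℚ-cong (setPartitions n) (λ {β} β∈ → begin
         𝟙 (β ≤? α) * ⟨ φ ⟩ (u β α *ₗ p β)
           ≡⟨ cong (𝟙 (β ≤? α) *_) (trans (⟨⟩-* φ (u β α) (p β))
                (cong (u β α *_) (x-coefficient-p σ⊢ (setPartitions-⊢ n β∈)))) ⟩
         𝟙 (β ≤? α) * (u β α * 𝟙 (σ ≤? β))
           ≡⟨ ℚ.*-assoc (𝟙 (β ≤? α)) _ _ ⟨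
         𝟙 (β ≤? α) * u β α * 𝟙 (σ ≤? β)
           ≡⟨ ℚ.*-comm _ (𝟙 (σ ≤? β)) ⟩
         𝟙 (σ ≤? β) * (𝟙 (β ≤? α) * u β α) ∎) ⟩
  ∑ℚ (setPartitions n) (λ β → 𝟙 (σ ≤? β) * (𝟙 (β ≤? α) * u β α))
    ≡⟨ by-size (n ℕ.≟ m) ⟩
  𝟙 (α ≋? σ) ∎
  where
  open ≡-Reasoning
  φ = x-coefficient σ
  by-size : Dec (n ≡ m) → ∑ℚ (setPartitions n) (λ β → 𝟙 (σ ≤? β) * (𝟙 (β ≤? α) * u β α)) ≡ 𝟙 (α ≋? σ)
  by-size (no n≢m) = trans
    (∑ℚ-zero (setPartitions n) λ {β} _ → trans
      (cong (_* (𝟙 (β ≤? α) * u β α)) (𝟙-false (σ ≤? β) λ σ≤β → n≢m (sym (≤-size σ≤β))))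
      (ℚ.*-zeroˡ (𝟙 (β ≤? α) * u β α)))
    (sym (𝟙-false (α ≋? σ) λ α≋σ → n≢m (≋-size α≋σ)))
  by-size (yes refl) = begin
    ∑ℚ (setPartitions n) (λ β → 𝟙 (σ ≤? β) * (𝟙 (β ≤? α) * u β α))
      ≡⟨ ∑ℚ-cong (setPartitions n) (λ {β} β∈ → let β⊢ = setPartitions-⊢ n β∈ in begin
           𝟙 (σ ≤? β) * (𝟙 (β ≤? α) * u β α)
             ≡⟨ cong₂ (λ s t → s * (t * u β α))
                  (𝟙-cong (≤⇔⇛ (_⊢_.nonempty σ⊢) (_⊢_.disjoint β⊢)) (σ ≤? β) (σ⇛β? β))
                  (𝟙-cong (≤⇔⇛ (_⊢_.nonempty β⊢) (_⊢_.disjoint α⊢)) (β ≤? α) (β⇛α? β)) ⟩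
           𝟙 (σ⇛β? β) * (𝟙 (β⇛α? β) * u β α)
             ≡⟨ ℚ.*-assoc (𝟙 (σ⇛β? β)) _ _ ⟨
           𝟙 (σ⇛β? β) * 𝟙 (β⇛α? β) * u β α
             ≡⟨ cong (_* u β α) (𝟙-× (σ⇛β? β) (β⇛α? β)) ⟨
           𝟙 (between? (together? σ) β (together? α)) * u β α ∎) ⟩
    ∑ℚ (setPartitions n) (λ β → 𝟙 (between? (together? σ) β (together? α)) * u β α)
      ≡⟨ ∑-between-u n (together-equivalence (⊢⇒weak σ⊢)) (together? σ) (⊢⇒weak α⊢) ⟩
    𝟙 (between? (together? σ) α (together? σ))
      ≡⟨ 𝟙-cong (≋⇔between α⊢ σ⊢) (α ≋? σ) (between? (together? σ) α (together? σ)) ⟨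
    𝟙 (α ≋? σ) ∎
    where
    σ⇛β? = λ β → ⇛? (together? σ) (together? β)
    β⇛α? = λ β → ⇛? (together? β) (together? α)

-- Standardization

-- The order-preserving injection with image `S`. Taking preimages under it is `relabel S`, so
-- questions about standardized blocks become questions about elements of the original ones.
embed : (S : Subset n) → Fin ∣ S ∣ → Fin n
embed (inside  ∷ S) zero    = zero
embed (inside  ∷ S) (suc i) = suc (embed S i)
embed (outside ∷ S) i       = suc (embed S i)

∈-embed : ∀ (S : Subset n) i → embed S i ∈ S
∈-embed (inside  ∷ S) zero    = here
∈-embed (inside  ∷ S) (suc i) = there (∈-embed S i)
∈-embed (outside ∷ S) i       = there (∈-embed S i)

embed-surjective : ∀ {S : Subset n} {j} → j ∈ S → ∃ λ i → embed S i ≡ j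
embed-surjective {S = inside  ∷ S} here        = zero , refl
embed-surjective {S = inside  ∷ S} (there j∈S) = let i , eq = embed-surjective j∈S in suc i , cong suc eq
embed-surjective {S = outside ∷ S} (there j∈S) = let i , eq = embed-surjective j∈S in i , cong suc eq

∈-relabel⁺ : ∀ (S B : Subset n) {i} → embed S i ∈ B → i ∈ relabel S B
∈-relabel⁺ (inside  ∷ S) (_ ∷ B) {zero}  here       = here
∈-relabel⁺ (inside  ∷ S) (_ ∷ B) {suc i} (there i∈) = there (∈-relabel⁺ S B i∈)
∈-relabel⁺ (outside ∷ S) (_ ∷ B)         (there i∈) = ∈-relabel⁺ S B i∈

∈-relabel⁻ : ∀ (S B : Subset n) {i} → i ∈ relabel S B → embed S i ∈ B
∈-relabel⁻ (inside  ∷ S) (_ ∷ B) here       = here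
∈-relabel⁻ (inside  ∷ S) (_ ∷ B) (there i∈) = there (∈-relabel⁻ S B i∈)
∈-relabel⁻ (outside ∷ S) (_ ∷ B) i∈         = there (∈-relabel⁻ S B i∈)

St-⊢ : ∀ {ν : Family n} S → ν ⊢ ⊤ → St S (ν ↾ S) ⊢ ⊤
St-⊢ {ν = ν} S ν⊢ = record
  { nonempty = All.map⁺ (All.zipWith relabel-nonempty
      ( All.all-filter nonempty? (map (_∩ S) ν)
      , All.filter⁺ nonempty? restrict-⊆))
  ; disjoint = AllPairs.map⁺ (AllPairs.map relabel-disjoint
      (AllPairs.filter⁺ nonempty? (AllPairs.map⁺ (AllPairs.map restrict-disjoint (_⊢_.disjoint ν⊢)))))
  ; union    = covering⁻ λ i →
      let B , B∈ν , i∈B = List.find (covering ν⊢ (embed S i))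
          i∈B∩S = x∈p∩q⁺ (i∈B , ∈-embed S i)
      in List.lose (∈-map⁺ (relabel S) (∈-filter⁺ nonempty? (∈-map⁺ (_∩ S) B∈ν) (embed S i , i∈B∩S)))
                   (∈-relabel⁺ S (B ∩ S) i∈B∩S)
  }
  where
  restrict-⊆ : All (_⊆ S) (map (_∩ S) ν)
  restrict-⊆ = All.map⁺ (All.tabulate λ {B} _ → p∩q⊆q B S)

  relabel-nonempty : ∀ {B} → Nonempty B × B ⊆ S → Nonempty (relabel S B)
  relabel-nonempty {B} ((j , j∈B) , B⊆S) with i , refl ← embed-surjective (B⊆S j∈B) = i , ∈-relabel⁺ S B j∈B

  relabel-disjoint : ∀ {A B} → Empty (A ∩ B) → Empty (relabel S A ∩ relabel S B)
  relabel-disjoint {A} {B} d (i , i∈) = let i∈A , i∈B = x∈p∩q⁻ (relabel S A) (relabel S B) i∈ in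
    d (embed S i , x∈p∩q⁺ (∈-relabel⁻ S A i∈A , ∈-relabel⁻ S B i∈B))

  restrict-disjoint : ∀ {A B} → Empty (A ∩ B) → Empty ((A ∩ S) ∩ (B ∩ S))
  restrict-disjoint {A} {B} d (i , i∈) = let i∈A , i∈B = x∈p∩q⁻ (A ∩ S) (B ∩ S) i∈ in
    d (i , x∈p∩q⁺ (p∩q⊆p A S i∈A , p∩q⊆p B S i∈B))

-- The span of the x α

-- Makes the number of listed partitions below `π` a strictly decreasing measure along refinement.
length-filter-< : ∀ {a p q} {A : Set a} {P : A → Set p} {Q : A → Set q}
                  (P? : U.Decidable P) (Q? : U.Decidable Q) →
                  (∀ {a} → P a → Q a) → ∀ {xs a} → a ∈ᴸ xs → ¬ P a → Q a →
                  length (filter P? xs) ℕ.< length (filter Q? xs)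
length-filter-< {A = A} {P} {Q} P? Q? P⊆Q = strict
  where
  weakly : ∀ (xs : List A) → length (filter P? xs) ℕ.≤ length (filter Q? xs)
  weakly [] = ℕ.z≤n
  weakly (y ∷ ys) with P? y | Q? y
  ... | yes _  | yes _  = ℕ.s≤s (weakly ys)
  ... | yes Py | no ¬Qy = contradiction (P⊆Q Py) ¬Qy
  ... | no _   | yes _  = ℕ.m≤n⇒m≤1+n (weakly ys)
  ... | no _   | no _   = weakly ys

  strict : ∀ {xs a} → a ∈ᴸ xs → ¬ P a → Q a → length (filter P? xs) ℕ.< length (filter Q? xs)
  strict {y ∷ ys} (here refl) ¬Py Qy with P? y | Q? y
  ... | yes Py | _      = contradiction Py ¬Py
  ... | no _   | yes _  = ℕ.s≤s (weakly ys)
  ... | no _   | no ¬Qy = contradiction Qy ¬Qy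
  strict {y ∷ ys} (there a∈) ¬Pa Qa with P? y | Q? y
  ... | yes _  | yes _  = ℕ.s≤s (strict a∈ ¬Pa Qa)
  ... | yes Py | no ¬Qy = contradiction (P⊆Q Py) ¬Qy
  ... | no _   | yes _  = ℕ.m<n⇒m<1+n (strict a∈ ¬Pa Qa)
  ... | no _   | no _   = strict a∈ ¬Pa Qa

≤-trans : ∀ {ρ : Family k} {σ : Family m} {π : Family n} → ρ ≤ σ → σ ≤ π → ρ ≤ π
≤-trans (refines ρ≤σ) (refines σ≤π) = refines (All.map
  (λ A⊆ → let B , B∈σ , A⊆B = List.find A⊆
              C , C∈π , B⊆C = List.find (All.lookup σ≤π B∈σ)
          in List.lose C∈π (λ {i} i∈A → B⊆C (A⊆B i∈A)))
  ρ≤σ)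

-- Existence is read off from the count: if no listed partition agreed with `π`, the sum in
-- `∑-between-self` would be 0 instead of 1.
listed : ∀ {π : Family n} → π ⊢ ⊤ → ∃ λ α → α ∈ᴸ setPartitions n × π ≤ α × α ≤ π
listed {n} {π} π⊢ with any? (λ α → between? (together? π) α (together? π)) (setPartitions n)
... | yes t = let α , α∈ , π⇛α , α⇛π = List.find t
                  α⊢ = setPartitions-⊢ n α∈
              in α , α∈ , from (≤⇔⇛ (_⊢_.nonempty π⊢) (_⊢_.disjoint α⊢)) π⇛α
                        , from (≤⇔⇛ (_⊢_.nonempty α⊢) (_⊢_.disjoint π⊢)) α⇛π
... | no ¬t = contradiction
  (trans (sym (∑ℚ-zero (setPartitions n) λ {α} α∈ →
                 𝟙-false (between? (together? π) α (together? π)) λ b → ¬t (List.lose α∈ b)))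
         (∑-between-self n (together-equivalence (⊢⇒weak π⊢)) (together? π)))
  λ ()

≤-antisym-≋ : ∀ {σ π : Family n} → σ ⊢ ⊤ → π ⊢ ⊤ → σ ≤ π → π ≤ σ → σ ≋ π
≤-antisym-≋ σ⊢ π⊢ σ≤π π≤σ = same (≤-antisym (_⊢_.nonempty σ⊢) (_⊢_.disjoint σ⊢) σ≤π π≤σ)
                                 (≤-antisym (_⊢_.nonempty π⊢) (_⊢_.disjoint π⊢) π≤σ σ≤π)

occursIn-≋ : ∀ {w} {σ π : Family n} → σ ≋ π → OccursIn w σ ⇔ OccursIn w π
occursIn-≋ (same σ⊆π π⊆σ) = mk⇔
  (λ (f , w≡ , c) → f , w≡ , All.tabulate λ A∈π → All.lookup c (π⊆σ A∈π))
  (λ (f , w≡ , c) → f , w≡ , All.tabulate λ A∈σ → All.lookup c (σ⊆π A∈σ))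

𝟙-split : ∀ {a b} {A : Set a} {B : Set b} (a? : Dec A) (b? : Dec B) →
          𝟙 a? ≡ 𝟙 (a? ×-dec b?) + 𝟙 (a? ×-dec ¬? b?)
𝟙-split (yes _) (yes _) = refl
𝟙-split (yes _) (no  _) = refl
𝟙-split (no  _) b?      = refl

strictlyBelow : Family n → List (Family n)
strictlyBelow {n} π = filter (λ σ → (σ ≤? π) ×-dec ¬? (π ≤? σ)) (setPartitions n)

-- Unitriangularity. The list `setPartitions` may contain `π` with its blocks in another order, so
-- the leading term of `x π` is not literally a multiple of `p π`; the terms with `σ` equal to `π`
-- have to be collected first.
p≈x-lower : ∀ {π : Family n} → π ⊢ ⊤ →
  p π ≈ (x π +ᴹ (ℚ.- 1ℚ) *ₗ ∑ +ᴹ-rawMonoid (strictlyBelow π) λ σ → u σ π *ₗ p σ)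
p≈x-lower {n} {π} π⊢ = mk≈ λ w → sym (begin
  coeff (x π) w + (ℚ.- 1ℚ) * coeff (∑ +ᴹ-rawMonoid (strictlyBelow π) λ σ → u σ π *ₗ p σ) w
    ≡⟨ cong₂ (λ s t → s + (ℚ.- 1ℚ) * t) (coeff-x w)
         (trans (⟨⟩-∑ (coeffᶠ w) (strictlyBelow π) _) (∑ℚ-filter (λ σ → (σ ≤? π) ×-dec ¬? (π ≤? σ)) (setPartitions n) _)) ⟩
  (coeff (p π) w + lower w) + (ℚ.- 1ℚ) * lower w
    ≡⟨ ℚ.+-assoc (coeff (p π) w) _ _ ⟩
  coeff (p π) w + (lower w + (ℚ.- 1ℚ) * lower w)
    ≡⟨ cong (coeff (p π) w +_) (cancel (lower w)) ⟩
  coeff (p π) w + 0ℚ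
    ≡⟨ ℚ.+-identityʳ _ ⟩
  coeff (p π) w ∎)
  where
  open ≡-Reasoning
  lower : List ℕ → ℚ
  lower w = ∑ℚ (setPartitions n) λ σ → 𝟙 ((σ ≤? π) ×-dec ¬? (π ≤? σ)) * (u σ π * coeff (p σ) w)

  cancel : ∀ q → q + (ℚ.- 1ℚ) * q ≡ 0ℚ
  cancel q = trans (cong (q +_) (trans (sym (ℚ.neg-distribˡ-* 1ℚ q)) (cong ℚ.-_ (ℚ.*-identityˡ q)))) (ℚ.+-inverseʳ q)

  equal? : ∀ σ → Dec (σ ≤ π × π ≤ σ)
  equal? σ = (σ ≤? π) ×-dec (π ≤? σ)

  between⇔ : ∀ {σ} → σ ∈ᴸ setPartitions n → (σ ≤ π × π ≤ σ) ⇔ Between (Together π) σ (Together π)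
  between⇔ σ∈ =
    let σ⊢ = setPartitions-⊢ n σ∈
        σ≤π⇔ = ≤⇔⇛ (_⊢_.nonempty σ⊢) (_⊢_.disjoint π⊢)
        π≤σ⇔ = ≤⇔⇛ (_⊢_.nonempty π⊢) (_⊢_.disjoint σ⊢)
    in mk⇔ (λ (σ≤π , π≤σ) → to π≤σ⇔ π≤σ , to σ≤π⇔ σ≤π) (λ (π⇛σ , σ⇛π) → from σ≤π⇔ σ⇛π , from π≤σ⇔ π⇛σ)

  -- The total Möbius weight of the listed copies of `π` is 1, by the diagonal case of `∑-between-u`
  -- with `Together π` as both bounds.
  upper : ∀ w → ∑ℚ (setPartitions n) (λ σ → 𝟙 (equal? σ) * (u σ π * coeff (p σ) w)) ≡ coeff (p π) w
  upper w = begin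
    ∑ℚ (setPartitions n) (λ σ → 𝟙 (equal? σ) * (u σ π * coeff (p σ) w))
      ≡⟨ ∑ℚ-cong (setPartitions n) (λ {σ} σ∈ → begin
           𝟙 (equal? σ) * (u σ π * coeff (p σ) w)
             ≡⟨ 𝟙*-cong (equal? σ) (λ (σ≤π , π≤σ) → cong (u σ π *_)
                  (𝟙-cong (occursIn-≋ (≤-antisym-≋ (setPartitions-⊢ n σ∈) π⊢ σ≤π π≤σ)) (occursIn? w σ) (occursIn? w π))) ⟩
           𝟙 (equal? σ) * (u σ π * coeff (p π) w)
             ≡⟨ ℚ.*-assoc (𝟙 (equal? σ)) _ _ ⟨
           𝟙 (equal? σ) * u σ π * coeff (p π) w
             ≡⟨ cong (λ t → t * u σ π * coeff (p π) w)
                    (𝟙-cong (between⇔ σ∈) (equal? σ) (between? (together? π) σ (together? π))) ⟩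
           𝟙 (between? (together? π) σ (together? π)) * u σ π * coeff (p π) w ∎) ⟩
    ∑ℚ (setPartitions n) (λ σ → 𝟙 (between? (together? π) σ (together? π)) * u σ π * coeff (p π) w)
      ≡⟨ ∑ℚ-* (setPartitions n) _ _ ⟨
    ∑ℚ (setPartitions n) (λ σ → 𝟙 (between? (together? π) σ (together? π)) * u σ π) * coeff (p π) w
      ≡⟨ cong (_* coeff (p π) w) (trans
           (∑-between-u n (together-equivalence (⊢⇒weak π⊢)) (together? π) (⊢⇒weak π⊢))
           (𝟙-true (between? (together? π) π (together? π)) ((λ _ _ t → t) , λ _ _ t → t))) ⟩
    1ℚ * coeff (p π) w
      ≡⟨ ℚ.*-identityˡ _ ⟩
    coeff (p π) w ∎

  coeff-x : ∀ w → coeff (x π) w ≡ coeff (p π) w + lower w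
  coeff-x w = begin
    coeff (x π) w
      ≡⟨ ⟨⟩-∑ (coeffᶠ w) (filter (_≤? π) (setPartitions n)) _ ⟩
    ∑ℚ (filter (_≤? π) (setPartitions n)) (λ σ → u σ π * coeff (p σ) w)
      ≡⟨ ∑ℚ-filter (_≤? π) (setPartitions n) _ ⟩
    ∑ℚ (setPartitions n) (λ σ → 𝟙 (σ ≤? π) * (u σ π * coeff (p σ) w))
      ≡⟨ ∑ℚ-cong (setPartitions n) (λ {σ} _ → trans
           (cong (_* (u σ π * coeff (p σ) w)) (𝟙-split (σ ≤? π) (π ≤? σ)))
           (ℚ.*-distribʳ-+ (u σ π * coeff (p σ) w) (𝟙 (equal? σ)) _)) ⟩
    ∑ℚ (setPartitions n) (λ σ → 𝟙 (equal? σ) * (u σ π * coeff (p σ) w)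
                              + 𝟙 ((σ ≤? π) ×-dec ¬? (π ≤? σ)) * (u σ π * coeff (p σ) w))
      ≡⟨ ∑ℚ-+ (setPartitions n) _ _ ⟩
    ∑ℚ (setPartitions n) (λ σ → 𝟙 (equal? σ) * (u σ π * coeff (p σ) w)) + lower w
      ≡⟨ cong (_+ lower w) (upper w) ⟩
    coeff (p π) w + lower w ∎

-- Abstracting the predicate lets the passage from the `x α` to the `p π` be made in either tensor
-- factor, with the other factor held fixed.
record IsSubspace (Q : NCSym → Set) : Set where
  field
    Q-cong : ∀ {f g} → f ≈ g → Q f → Q g
    Q-0    : Q 0ᴹ
    Q-+    : ∀ {f g} → Q f → Q g → Q (f +ᴹ g)
    Q-*    : ∀ q {f} → Q f → Q (q *ₗ f)

  Q-∑ : ∀ {a} {A : Set a} (as : List A) {f : A → NCSym} → (∀ {a} → a ∈ᴸ as → Q (f a)) → Q (∑ +ᴹ-rawMonoid as f)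
  Q-∑ []       Qf = Q-0
  Q-∑ (a ∷ as) Qf = Q-+ (Qf (here refl)) (Q-∑ as (Qf ∘ there))

  x⇒p : (∀ {n} {α : Family n} → α ⊢ ⊤ → Q (x α)) → ∀ {n} {π : Family n} → π ⊢ ⊤ → Q (p π)
  x⇒p Qx {n} π⊢ = go π⊢ (<-wellFounded _)
    where
    go : ∀ {π : Family n} → π ⊢ ⊤ → Acc ℕ._<_ (length (filter (_≤? π) (setPartitions n))) → Q (p π)
    go {π} π⊢ (acc smaller) = Q-cong (mk≈ λ w → sym (_≈_.coeff-≡ (p≈x-lower π⊢) w))
      (Q-+ (Qx π⊢) (Q-* (ℚ.- 1ℚ) (Q-∑ (strictlyBelow π) λ {σ} σ∈ →
        let σ∈L , σ≤π , π≰σ = ∈-filter⁻ (λ σ → (σ ≤? π) ×-dec ¬? (π ≤? σ)) {xs = setPartitions n} σ∈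
            -- The listed copy `α` of `π` is counted below `π` but not below `σ`, so the measure
            -- drops strictly.
            α , α∈L , π≤α , α≤π = listed π⊢
        in Q-* (u σ π) (go (setPartitions-⊢ n σ∈L) (smaller
             (length-filter-< (_≤? σ) (_≤? π) (λ ρ≤σ → ≤-trans ρ≤σ σ≤π) α∈L
               (λ α≤σ → π≰σ (≤-trans π≤α α≤σ)) α≤π))))))

-- Tensors

private
  module ⊗ = TensorProduct ℚ.+-*-commutativeRing ncsym ncsym
open ⊗ using (0ᵗ; _+ᵗ_; -ᵗ_; _*ᵗ_; _≈ᵗ_; reflᵗ; symᵗ; transᵗ)

-- The functional `F` ⊗ `G`, first on formal expressions; that it descends to tensors is
-- `evaluate-cong`.
evaluate : Functional → Functional → Tensor → ℚ
evaluate F G (f ⊗ g)  = ⟨ F ⟩ f * ⟨ G ⟩ g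
evaluate F G 0ᵗ       = 0ℚ
evaluate F G (s +ᵗ t) = evaluate F G s + evaluate F G t
evaluate F G (-ᵗ t)   = ℚ.- evaluate F G t
evaluate F G (q *ᵗ t) = q * evaluate F G t

module _ (F G : Functional) where

  private
    ev = evaluate F G

  evaluate-cong : ∀ {s t} → s ≈ᵗ t → ev s ≡ ev t
  evaluate-cong reflᵗ                 = refl
  evaluate-cong (symᵗ p)              = sym (evaluate-cong p)
  evaluate-cong (transᵗ p q)          = trans (evaluate-cong p) (evaluate-cong q)
  evaluate-cong (⊗.+-cong p q)        = cong₂ _+_ (evaluate-cong p) (evaluate-cong q)
  evaluate-cong (⊗.-‿cong p)          = cong ℚ.-_ (evaluate-cong p)
  evaluate-cong (⊗.*-cong p q)        = cong₂ _*_ p (evaluate-cong q)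
  evaluate-cong (⊗.+-assoc s t v)     = ℚ.+-assoc (ev s) (ev t) (ev v)
  evaluate-cong (⊗.+-comm s t)        = ℚ.+-comm (ev s) (ev t)
  evaluate-cong (⊗.+-identityˡ s)     = ℚ.+-identityˡ (ev s)
  evaluate-cong (⊗.-‿inverseˡ s)      = ℚ.+-inverseˡ (ev s)
  evaluate-cong (⊗.*-identityˡ s)     = ℚ.*-identityˡ (ev s)
  evaluate-cong (⊗.*-assoc a b s)     = ℚ.*-assoc a b (ev s)
  evaluate-cong (⊗.*-distribˡ a s t)  = ℚ.*-distribˡ-+ a (ev s) (ev t)
  evaluate-cong (⊗.*-distribʳ s a b)  = ℚ.*-distribʳ-+ (ev s) a b
  evaluate-cong (⊗.*-zeroˡ s)         = ℚ.*-zeroˡ (ev s)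
  evaluate-cong (⊗.*-zeroʳ a)         = ℚ.*-zeroʳ a
  evaluate-cong (⊗.⊗-cong p q)        = cong₂ _*_ (⟨⟩-cong F p) (⟨⟩-cong G q)
  evaluate-cong (⊗.⊗-distribʳ f f′ g) =
    trans (cong (_* ⟨ G ⟩ g) (⟨⟩-+ F f f′)) (ℚ.*-distribʳ-+ (⟨ G ⟩ g) (⟨ F ⟩ f) (⟨ F ⟩ f′))
  evaluate-cong (⊗.⊗-distribˡ f g g′) =
    trans (cong (⟨ F ⟩ f *_) (⟨⟩-+ G g g′)) (ℚ.*-distribˡ-+ (⟨ F ⟩ f) (⟨ G ⟩ g) (⟨ G ⟩ g′))
  evaluate-cong (⊗.⊗-scaleˡ a f g)    =
    trans (cong (_* ⟨ G ⟩ g) (⟨⟩-* F a f)) (ℚ.*-assoc a (⟨ F ⟩ f) (⟨ G ⟩ g))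
  evaluate-cong (⊗.⊗-scaleʳ a f g)    =
    trans (cong (⟨ F ⟩ f *_) (⟨⟩-* G a g)) (*ℚ.x∙yz≈y∙xz (⟨ F ⟩ f) a (⟨ G ⟩ g))

  evaluate-∑ : ∀ {a} {A : Set a} (as : List A) (t : A → Tensor) → ev (∑⊗ as t) ≡ ∑ℚ as (ev ∘ t)
  evaluate-∑ []       t = refl
  evaluate-∑ (a ∷ as) t = cong (ev (t a) +_) (evaluate-∑ as t)

open SetPartition

evaluate-combination : ∀ {k l} {σ : Family k} {τ : Family l} → σ ⊢ ⊤ → τ ⊢ ⊤ → ∀ e →
  evaluate (x-coefficient σ) (x-coefficient τ) (combination e) ≡ coefficient σ τ e
evaluate-combination {σ = σ} {τ} σ⊢ τ⊢ e = begin
  evaluate (x-coefficient σ) (x-coefficient τ) (combination e)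
    ≡⟨ evaluate-∑ (x-coefficient σ) (x-coefficient τ) e _ ⟩
  ∑ℚ e (λ (q , α , β) → q * (⟨ x-coefficient σ ⟩ (x (blocks α)) * ⟨ x-coefficient τ ⟩ (x (blocks β))))
    ≡⟨ ∑ℚ-cong e (λ {(q , α , β)} _ → trans
         (cong (q *_) (trans
           (cong₂ _*_ (x-coefficient-x σ⊢ (isPartition α)) (x-coefficient-x τ⊢ (isPartition β)))
           (sym (𝟙-× (blocks α ≋? σ) (blocks β ≋? τ)))))
         (ℚ.*-comm q _)) ⟩
  ∑ℚ e (λ (q , α , β) → 𝟙 ((blocks α ≋? σ) ×-dec (blocks β ≋? τ)) * q)
    ≡⟨ ∑ℚ-filter (λ (_ , α , β) → (blocks α ≋? σ) ×-dec (blocks β ≋? τ)) e proj₁ ⟨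
  coefficient σ τ e ∎
  where open ≡-Reasoning

-- The span of the tensors x α ⊗ x β

InSpan : Tensor → Set
InSpan t = ∃ λ e → t ≈ᵗ combination e

span-cong : ∀ {s t} → s ≈ᵗ t → InSpan t → InSpan s
span-cong s≈t (e , t≈) = e , transᵗ s≈t t≈

span-+ : ∀ {s t} → InSpan s → InSpan t → InSpan (s +ᵗ t)
span-+ (e , s≈) (e′ , t≈) = e ++ e′ , transᵗ (⊗.+-cong s≈ t≈) (symᵗ (∑-++ NC⊗NC.+ᴹ-monoid e e′ _))

span-* : ∀ q {t} → InSpan t → InSpan (q *ᵗ t)
span-* q (e , t≈) = map (map₁ (q *_)) e , transᵗ (⊗.*-cong refl t≈) (scale e)
  where
  scale : ∀ e → q *ᵗ combination e ≈ᵗ combination (map (map₁ (q *_)) e)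
  scale []                = ⊗.*-zeroʳ q
  scale ((r , α , β) ∷ e) = transᵗ (⊗.*-distribˡ q _ _) (⊗.+-cong (symᵗ (⊗.*-assoc q r _)) (scale e))

span-∑ : ∀ {a} {A : Set a} (as : List A) {t : A → Tensor} → (∀ {a} → a ∈ᴸ as → InSpan (t a)) → InSpan (∑⊗ as t)
span-∑ []       t∈ = [] , reflᵗ
span-∑ (a ∷ as) t∈ = span-+ (t∈ (here refl)) (span-∑ as (t∈ ∘ there))

-- That a zero factor kills a tensor is not among the generating relations. It follows from scaling,
-- with `0ᴹ` written as `0ℚ *ₗ 0ᴹ`.
span-zeroˡ : ∀ g → InSpan (0ᴹ ⊗ g)
span-zeroˡ g = [] , transᵗ (⊗.⊗-cong (NC.≈ᴹ-sym (NC.*ₗ-zeroˡ 0ᴹ)) NC.≈ᴹ-refl)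
  (transᵗ (⊗.⊗-scaleˡ 0ℚ _ g) (⊗.*-zeroˡ _))

span-zeroʳ : ∀ f → InSpan (f ⊗ 0ᴹ)
span-zeroʳ f = [] , transᵗ (⊗.⊗-cong NC.≈ᴹ-refl (NC.≈ᴹ-sym (NC.*ₗ-zeroˡ 0ᴹ)))
  (transᵗ (⊗.⊗-scaleʳ 0ℚ f _) (⊗.*-zeroˡ _))

-- One factor at a time: with `x β` fixed on the right, pass from the `x α` to `p α`; then, with
-- `p α` fixed on the left, from the `x β` to `p β`.
span-p⊗p : ∀ {α : Family m} {β : Family n} → α ⊢ ⊤ → β ⊢ ⊤ → InSpan (p α ⊗ p β)
span-p⊗p {α = α} α⊢ β⊢ = IsSubspace.x⇒p right
  (λ {_} {β} β⊢ → IsSubspace.x⇒p (left (x β)) (λ {_} {α} α⊢ →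
    (1ℚ , record { isPartition = α⊢ } , record { isPartition = β⊢ }) ∷ []
    , symᵗ (transᵗ (⊗.+-comm _ 0ᵗ) (transᵗ (⊗.+-identityˡ _) (⊗.*-identityˡ _)))) α⊢)
  β⊢
  where
  left : ∀ g → IsSubspace λ f → InSpan (f ⊗ g)
  left g = record
    { Q-cong = λ f≈f′ → span-cong (⊗.⊗-cong (NC.≈ᴹ-sym f≈f′) NC.≈ᴹ-refl)
    ; Q-0    = span-zeroˡ g
    ; Q-+    = λ s t → span-cong (⊗.⊗-distribʳ _ _ g) (span-+ s t)
    ; Q-*    = λ q t → span-cong (⊗.⊗-scaleˡ q _ g) (span-* q t)
    }
  right : IsSubspace λ g → InSpan (p α ⊗ g)
  right = record
    { Q-cong = λ g≈g′ → span-cong (⊗.⊗-cong NC.≈ᴹ-refl (NC.≈ᴹ-sym g≈g′))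
    ; Q-0    = span-zeroʳ (p α)
    ; Q-+    = λ s t → span-cong (⊗.⊗-distribˡ (p α) _ _) (span-+ s t)
    ; Q-*    = λ q t → span-cong (⊗.⊗-scaleʳ q (p α) _) (span-* q t)
    }

-- The coproduct of x and its coefficients

Δp Δx : ∀ {n} → Family n → Tensor
Δp {n} π = ∑⊗ (filter (splits? π) (decompositions n)) λ (S₁ , S₂) → p (St S₁ (π ↾ S₁)) ⊗ p (St S₂ (π ↾ S₂))
Δx {n} π = ∑⊗ (filter (_≤? π) (setPartitions n)) λ ν → u ν π *ᵗ Δp ν

module _ {Δ : NCSym → Tensor} (isCoproduct : IsCoproduct Δ) where
  open IsCoproduct isCoproduct
  open LeftModuleMorphisms.IsLeftModuleHomomorphism linear using (+ᴹ-homo; 0ᴹ-homo; *ₗ-homo)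

  Δ-∑ : ∀ {a} {A : Set a} (as : List A) (f : A → NCSym) → Δ (∑ +ᴹ-rawMonoid as f) ≈ᵗ ∑⊗ as (Δ ∘ f)
  Δ-∑ []       f = 0ᴹ-homo
  Δ-∑ (a ∷ as) f = transᵗ (+ᴹ-homo (f a) _) (⊗.+-cong reflᵗ (Δ-∑ as f))

  Δ-x : ∀ {n} (π : Family n) → Δ (x π) ≈ᵗ Δx π
  Δ-x {n} π = transᵗ (Δ-∑ L _) (∑-cong NC⊗NC.+ᴹ-monoid L λ {ν} ν∈ →
    transᵗ (*ₗ-homo (u ν π) (p ν))
      (⊗.*-cong refl (Δ-p ν (setPartitions-⊢ n (proj₁ (∈-filter⁻ (_≤? π) {xs = setPartitions n} ν∈))))))
    where L = filter (_≤? π) (setPartitions n)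

span-Δx : ∀ {n} (π : Family n) → InSpan (Δx π)
span-Δx {n} π = span-∑ (filter (_≤? π) (setPartitions n)) λ {ν} ν∈ →
  span-* (u ν π) (span-∑ (filter (splits? ν) (decompositions n)) λ {(S₁ , S₂)} _ →
    let ν⊢ = setPartitions-⊢ n (proj₁ (∈-filter⁻ (_≤? π) {xs = setPartitions n} ν∈))
    in span-p⊗p (St-⊢ S₁ ν⊢) (St-⊢ S₂ ν⊢))

-- The product over the blocks of `⟦ n ⟧` has a single factor, and that factor counts all blocks of
-- `ν`. This is where the summand of the theorem comes from.
u-⟦⟧ : ∀ (ν : Family n) → u ν ⟦ n ⟧ ≡ signedFactorial (ℓ ν)
u-⟦⟧ ν = trans (ℚ.*-identityʳ (signedFactorial (# ν ⊤)))
  (cong (signedFactorial ∘ length) (filter-all (_⊆? ⊤) {ν} (All.tabulate λ _ → ⊆⊤)))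

-- On each term of `Δp ν` the two functionals give the two refinement indicators; multiplied by the
-- indicator of the splitting condition they form the indicator of an admissible triple.
evaluate-Δx : ∀ n {k l} {σ : Family k} {τ : Family l} → σ ⊢ ⊤ → τ ⊢ ⊤ →
  evaluate (x-coefficient σ) (x-coefficient τ) (Δx ⟦ n ⟧) ≡
  ∑ℚ (triples n σ τ) λ (ν , S₁ , S₂) → signedFactorial (ℓ ν)
evaluate-Δx n {σ = σ} {τ} σ⊢ τ⊢ = begin
  evaluate F G (Δx ⟦ n ⟧)
    ≡⟨ evaluate-∑ F G (filter (_≤? ⟦ n ⟧) (setPartitions n)) _ ⟩
  ∑ℚ (filter (_≤? ⟦ n ⟧) (setPartitions n)) (λ ν → u ν ⟦ n ⟧ * evaluate F G (Δp ν))
    ≡⟨ ∑ℚ-filter (_≤? ⟦ n ⟧) (setPartitions n) _ ⟩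
  ∑ℚ (setPartitions n) (λ ν → 𝟙 (ν ≤? ⟦ n ⟧) * (u ν ⟦ n ⟧ * evaluate F G (Δp ν)))
    ≡⟨ ∑ℚ-cong (setPartitions n) (λ {ν} ν∈ → begin
         𝟙 (ν ≤? ⟦ n ⟧) * (u ν ⟦ n ⟧ * evaluate F G (Δp ν))
           ≡⟨ cong₂ (λ s t → s * (t * evaluate F G (Δp ν)))
                (𝟙-true (ν ≤? ⟦ n ⟧) (refines (All.tabulate λ _ → here ⊆⊤))) (u-⟦⟧ ν) ⟩
         1ℚ * (signedFactorial (ℓ ν) * evaluate F G (Δp ν))
           ≡⟨ ℚ.*-identityˡ _ ⟩
         signedFactorial (ℓ ν) * evaluate F G (Δp ν)
           ≡⟨ cong (signedFactorial (ℓ ν) *_) (evaluate-Δp ν (setPartitions-⊢ n ν∈)) ⟩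
         signedFactorial (ℓ ν) * ∑ℚ (decompositions n) (λ S → 𝟙 (admissible? σ τ (ν , S)))
           ≡⟨ *-∑ℚ (signedFactorial (ℓ ν)) (decompositions n) _ ⟩
         ∑ℚ (decompositions n) (λ S → signedFactorial (ℓ ν) * 𝟙 (admissible? σ τ (ν , S)))
           ≡⟨ ∑ℚ-cong (decompositions n) (λ {S} _ → ℚ.*-comm (signedFactorial (ℓ ν)) _) ⟩
         ∑ℚ (decompositions n) (λ S → 𝟙 (admissible? σ τ (ν , S)) * signedFactorial (ℓ ν)) ∎) ⟩
  ∑ℚ (setPartitions n) (λ ν → ∑ℚ (decompositions n) λ S → 𝟙 (admissible? σ τ (ν , S)) * signedFactorial (ℓ ν))
    ≡⟨ ∑-cartesianProduct ℚ.+-0-monoid (setPartitions n) (decompositions n) _ ⟨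
  ∑ℚ (cartesianProduct (setPartitions n) (decompositions n))
       (λ t → 𝟙 (admissible? σ τ t) * signedFactorial (ℓ (proj₁ t)))
    ≡⟨ ∑ℚ-filter (admissible? σ τ) (cartesianProduct (setPartitions n) (decompositions n)) _ ⟨
  ∑ℚ (triples n σ τ) (λ (ν , S₁ , S₂) → signedFactorial (ℓ ν)) ∎
  where
  open ≡-Reasoning
  F = x-coefficient σ
  G = x-coefficient τ

  evaluate-Δp : ∀ ν → ν ⊢ ⊤ → evaluate F G (Δp ν) ≡ ∑ℚ (decompositions n) (λ S → 𝟙 (admissible? σ τ (ν , S)))
  evaluate-Δp ν ν⊢ = trans (evaluate-∑ F G (filter (splits? ν) (decompositions n)) _)
    (trans (∑ℚ-filter (splits? ν) (decompositions n) _)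
      (∑ℚ-cong (decompositions n) λ {(S₁ , S₂)} _ → begin
        𝟙 (splits? ν (S₁ , S₂)) * (⟨ F ⟩ (p (St S₁ (ν ↾ S₁))) * ⟨ G ⟩ (p (St S₂ (ν ↾ S₂))))
          ≡⟨ cong (𝟙 (splits? ν (S₁ , S₂)) *_) (cong₂ _*_
               (x-coefficient-p σ⊢ (St-⊢ S₁ ν⊢)) (x-coefficient-p τ⊢ (St-⊢ S₂ ν⊢))) ⟩
        𝟙 (splits? ν (S₁ , S₂)) * (𝟙 (σ ≤? St S₁ (ν ↾ S₁)) * 𝟙 (τ ≤? St S₂ (ν ↾ S₂)))
          ≡⟨ cong (𝟙 (splits? ν (S₁ , S₂)) *_) (𝟙-× (σ ≤? St S₁ (ν ↾ S₁)) (τ ≤? St S₂ (ν ↾ S₂))) ⟨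
        𝟙 (splits? ν (S₁ , S₂)) * 𝟙 ((σ ≤? St S₁ (ν ↾ S₁)) ×-dec (τ ≤? St S₂ (ν ↾ S₂)))
          ≡⟨ 𝟙-× (splits? ν (S₁ , S₂)) ((σ ≤? St S₁ (ν ↾ S₁)) ×-dec (τ ≤? St S₂ (ν ↾ S₂))) ⟨
        𝟙 (admissible? σ τ (ν , S₁ , S₂)) ∎))

corollary3p3 : ∀ (n : ℕ) → n ≥ 1 →
    ∀ {k l} (σ : Family k) (τ : Family l) → σ ⊢ ⊤ → τ ⊢ ⊤ →
    ∀ (Δ : NCSym → Tensor) → IsCoproduct Δ →
    HasCoefficient (Δ (x ⟦ n ⟧)) σ τ
    (∑ℚ (triples n σ τ) λ (ν , S₁ , S₂) → signedFactorial (ℓ ν))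
corollary3p3 n _ σ τ σ⊢ τ⊢ Δ isCoproduct = record
  { expansion = span-cong (Δ-x isCoproduct ⟦ n ⟧) (span-Δx ⟦ n ⟧)
  ; unique    = λ e Δx≈e → trans (sym (evaluate-combination σ⊢ τ⊢ e))
      (trans (evaluate-cong F G (transᵗ (symᵗ Δx≈e) (Δ-x isCoproduct ⟦ n ⟧))) (evaluate-Δx n σ⊢ τ⊢))
  }
  where
  F = x-coefficient σ
  G = x-coefficient τ
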